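{- Let $p$ be a prime, let $q=p^e$ with $q \equiv 1 \pmod 3$, and let $G$ be the transitive permutation group arising from the action of $\mathrm{PSL}(2,q)$ (by left multiplication) on the set of left cosets of a subgroup of order $3$. Then $$\rho(G)=\begin{cases} 4/3 & \text{if } p \ne 5,\\ 2 & \text{if } p=5.\end{cases}$$
   Context: For a finite permutation group $G\le \mathrm{Sym}(V)$, a subset $\mathcal{F}\subseteq G$ is intersecting if for any $g,h\in\mathcal{F}$ there is $v\in V$ with $g(v)=h(v)$. The intersection density of an intersecting set $\mathcal{F}$ is $|\mathcal{F}|/\max\{|G_v| : v\in V\}$, where $G_v$ is the stabilizer of $v$, and the intersection density $\rho(G)$ of $G$ is the maximum of this quantity over all intersecting sets $\mathcal{F}$ of $G$. -}

module Defs where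

open import Level using (0ℓ)
open import Data.Nat using (ℕ; zero; suc; _≤_)
open import Data.Fin using (Fin)
open import Data.Product using (Σ; ∃; _×_; _,_)
open import Data.Sum using (_⊎_)
open import Data.List using (List; length)
open import Data.List.Membership.Propositional using (_∈_)
open import Data.List.Relation.Unary.All using (All)
open import Data.List.Relation.Unary.Any using (Any)
open import Data.List.Relation.Unary.AllPairs using (AllPairs)
open import Relation.Binary.PropositionalEquality using (_≡_)
open import Relation.Nullary using (¬_)
open import Function.Bundles using (_↔_)
open import Algebra.Structures using (IsCommutativeRing)

record FiniteField (q : ℕ) : Set₁ where
  infixl 6 _+_
  infixl 7 _*_
  field
    Carrier  : Set
    _+_ _*_  : Carrier → Carrier → Carrier
    -_       : Carrier → Carrier
    0# 1#    : Carrier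
    isCommutativeRing : IsCommutativeRing _≡_ _+_ _*_ -_ 0# 1#
    0≢1      : ¬ (0# ≡ 1#)
    inverse  : ∀ x → ¬ (x ≡ 0#) → ∃ λ y → x * y ≡ 1#
    enumeration : Fin q ↔ Carrier

module PSL2 {q : ℕ} (K : FiniteField q) where
  open FiniteField K

  record Mat : Set where
    constructor mat
    field a b c d : Carrier
  open Mat

  _·_ : Mat → Mat → Mat
  x · y = mat (a x * a y + b x * c y) (a x * b y + b x * d y)
              (c x * a y + d x * c y) (c x * b y + d x * d y)

  det : Mat → Carrier
  det x = a x * d x + - (b x * c x)

  I : Mat
  I = mat 1# 0# 0# 1#

  negM : Mat → Mat
  negM x = mat (- a x) (- b x) (- c x) (- d x)

  -- adjugate; equals the inverse for matrices of determinant 1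
  adj : Mat → Mat
  adj x = mat (d x) (- b x) (- c x) (a x)

  _^M_ : Mat → ℕ → Mat
  x ^M zero = I
  x ^M suc n = x · (x ^M n)

  SL : Mat → Set
  SL x = det x ≡ 1#

  -- equality in PSL(2,K) = SL(2,K)/{±I}
  _≈P_ : Mat → Mat → Set
  x ≈P y = x ≡ y ⊎ x ≡ negM y

  Order3 : Mat → Set
  Order3 t = SL t × ¬ (t ≈P I) × ((t ^M 3) ≈P I)

  module Action (t : Mat) where
    -- the subgroup H = ⟨t̄⟩ = {1, t̄, t̄²} of PSL(2,K), as a predicate on SL(2,K)
    InH : Mat → Set
    InH g = ∃ λ (k : Fin 3) → g ≈P (t ^M Data.Fin.toℕ k)

    -- x H = y H  (points of V are left cosets, represented by elements of SL)
    _∼_ : Mat → Mat → Set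
    x ∼ y = InH (adj x · y)

    AgreeAt : Mat → Mat → Mat → Set
    AgreeAt g h x = (g · x) ∼ (h · x)

    -- g and h induce the same permutation of V (same element of G)
    SamePerm : Mat → Mat → Set
    SamePerm g h = ∀ x → SL x → AgreeAt g h x

    Enumerates : (Mat → Set) → List Mat → Set
    Enumerates P L =
      All (λ g → SL g × P g) L ×
      AllPairs (λ g h → ¬ SamePerm g h) L ×
      (∀ g → SL g → P g → Any (SamePerm g) L)

    Fixes : Mat → Mat → Set
    Fixes x g = AgreeAt g I x

    MaxStab : ℕ → Set
    MaxStab s =
      (∃ λ x → SL x × ∃ λ L → Enumerates (Fixes x) L × length L ≡ s) ×
      (∀ x L → SL x → Enumerates (Fixes x) L → length L ≤ s)

    Intersecting : List Mat → Set
    Intersecting L =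
      All SL L ×
      AllPairs (λ g h → ¬ SamePerm g h) L ×
      AllPairs (λ g h → ∃ λ x → SL x × AgreeAt g h x) L

    -- ρ(G) = num / den, where s = max |G_v|
    Density : (s num den : ℕ) → Set
    Density s num den =
      (∃ λ L → Intersecting L × length L Data.Nat.* den ≡ num Data.Nat.* s) ×
      (∀ L → Intersecting L → length L Data.Nat.* den ≤ num Data.Nat.* s)

{-# OPTIONS --safe #-}

-- Write B(g, h) = tr(g⁻¹h). Two different elements of PSL(2, q) agree on a coset iff g⁻¹h is conjugate to t or t⁻¹,
-- which for SL-representatives means B(g, h) = ±1. As q ≡ 1 mod 3, there is w with w² = w − 1, and every element of
-- trace 1 is conjugate to D = diag(w, 1 − w). Hence an intersecting set can be moved so that it contains I and D.
-- Up to sign its other elements then have trace 1, and B(D, ·) = ±1 fixes their diagonals. Since B is minus the polar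
-- form of bc on the off-diagonal entries, B = ±1 prescribes the Gram matrix of vectors (b, c) of a hyperbolic plane.
-- The Gram determinant of three such vectors vanishes. For each choice of signs this determinant is an explicit
-- integer with only the prime factors 3 and 5 once halved, so in characteristic other than 5 at most two further
-- elements exist. In characteristic 5 some sign patterns survive, but no five vectors have all ten triples surviving.

module Submission where

open import Defs
open import Algebra.Bundles using (CommutativeRing)
import Algebra.Properties.CommutativeMonoid.Sum as CMSum
import Algebra.Properties.Ring
import Algebra.Properties.Semiring.Mult.TCOptimised
import Algebra.Solver.Ring
open import Algebra.Solver.Ring.AlmostCommutativeRing using (fromCommutativeRing; _-Raw-AlmostCommutative⟶_)
open import Data.Bool using (Bool; true; false; if_then_else_)
open import Data.Fin as Fin using (Fin; zero; suc; toℕ)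
open import Data.Fin.Permutation using (Permutation′; permutation)
import Data.Fin.Properties as Fin
open import Data.Integer as ℤ using (ℤ; +_; -[1+_]; _⊖_)
open import Data.Integer.Divisibility.Signed as ℤ using (divides)
import Data.Integer.Properties as ℤ
open import Data.List using (List; []; _∷_; length; lookup)
open import Data.List.Membership.Propositional.Properties using (∈-lookup)
open import Data.List.Relation.Unary.All as All using (All; []; _∷_)
open import Data.List.Relation.Unary.AllPairs as AllPairs using (AllPairs; []; _∷_)
open import Data.List.Relation.Unary.Any using (Any; here; there)
open import Data.Maybe as Maybe using (Maybe)
open import Data.Nat as ℕ using (ℕ; zero; suc; _<_; _≤_; z≤n; s≤s; _^_; _%_)
open import Data.Nat.Divisibility as ℕ using (divides; m%n≡0⇒n∣m; n∣m⇒m%n≡0)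
open import Data.Nat.DivMod using (_/_; m≡m%n+[m/n]*n; [m+kn]%n≡m%n; m%n<n)
open import Data.Nat.Primality using (Prime; prime⇒irreducible)
import Data.Nat.Properties as ℕ
open import Data.Product using (∃; _×_; _,_; proj₁; proj₂)
open import Data.Sum using (_⊎_; inj₁; inj₂; [_,_]′)
open import Function using (_∘_; case_of_; id)
open import Function.Bundles using (Inverse)
open import Function.Properties.Inverse using (↔-sym; ↔⇒↣)
open import Level using (0ℓ)
open import Relation.Binary.Definitions using (DecidableEquality; tri<; tri≈; tri>)
open import Relation.Binary.PropositionalEquality hiding (setoid)
open import Relation.Nullary using (¬_; Dec; yes; no; does; contradiction; ¬?)
open import Relation.Nullary.Decidable
  using (dec-true; dec⇒maybe; dec-false; decidable-stable; from-yes; map′; via-injection; _×-dec_; _→-dec_)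

-- The diagonals fixed by B(D, ·) = ±1 involve w, yet w² = w - 1 turns 3bc and 3(bc′ + cb′) into
-- integers that depend on signs alone. One finite check over ℤ therefore serves all fields at once.
-- It is recorded as divisibility of 3645 by the half determinant, because a merely nonzero integer
-- could still vanish in K.
--
-- The root w comes from counting instead of from the structure of the unit group: x ↦ 1/(1 - x) has
-- order 3 on the q + 1 points of the projective line, and q + 1 ≡ 2 mod 3 forces a fixed point.
--
-- Elements of G are compared through their action on cosets, so passing between traces and
-- distinctness requires faithfulness. All conjugates of a kernel element lie in the abelian group
-- H, which forces its trace to be ±2, and this is not ±1 outside characteristic 3.

-- Fixed points of maps of order three

lt : ℕ → ℕ → ℕ
lt a b = if does (a ℕ.<? b) then 1 else 0

lt-yes : ∀ {a b} → a < b → lt a b ≡ 1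
lt-yes {a} {b} a<b rewrite dec-true (a ℕ.<? b) a<b = refl

lt-no : ∀ {a b} → ¬ (a < b) → lt a b ≡ 0
lt-no {a} {b} a≮b rewrite dec-false (a ℕ.<? b) a≮b = refl

-- The three products indicate that a, b or c is the least. Their cyclic shape is the one that
-- `isMin` produces along an orbit i, f i, f (f i).
least-count : ∀ a b c → a ≢ b → b ≢ c → c ≢ a →
  lt a b ℕ.* lt a c ℕ.+ (lt b c ℕ.* lt b a ℕ.+ lt c a ℕ.* lt c b) ≡ 1
least-count a b c a≢b b≢c c≢a with ℕ.<-cmp a b | ℕ.<-cmp b c | ℕ.<-cmp c a
... | tri≈ _ a≡b _ | _ | _ = contradiction a≡b a≢b
... | _ | tri≈ _ b≡c _ | _ = contradiction b≡c b≢c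
... | _ | _ | tri≈ _ c≡a _ = contradiction c≡a c≢a
... | tri< p _ p' | tri< q _ q' | tri< r _ r' = contradiction (ℕ.<-trans p q) r'
... | tri> p' _ p | tri> q' _ q | tri> r' _ r = contradiction (ℕ.<-trans q p) r'
... | tri< p _ p' | tri< q _ q' | tri> r' _ r
  rewrite lt-yes p | lt-no p' | lt-yes q | lt-no q' | lt-yes r | lt-no r' = refl
... | tri< p _ p' | tri> q' _ q | tri< r _ r'
  rewrite lt-yes p | lt-no p' | lt-yes q | lt-no q' | lt-yes r | lt-no r' = refl
... | tri< p _ p' | tri> q' _ q | tri> r' _ r
  rewrite lt-yes p | lt-no p' | lt-yes q | lt-no q' | lt-yes r | lt-no r' = refl
... | tri> p' _ p | tri< q _ q' | tri< r _ r'
  rewrite lt-yes p | lt-no p' | lt-yes q | lt-no q' | lt-yes r = refl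
... | tri> p' _ p | tri< q _ q' | tri> r' _ r
  rewrite lt-yes p | lt-no p' | lt-yes q | lt-no q' | lt-no r' = refl
... | tri> p' _ p | tri> q' _ q | tri< r _ r'
  rewrite lt-yes p | lt-no p' | lt-yes q | lt-no q' | lt-yes r = refl

module ΣN = CMSum ℕ.+-0-commutativeMonoid

sum-ones : ∀ n → ΣN.sum {n} (λ _ → 1) ≡ n
sum-ones zero    = refl
sum-ones (suc n) = cong suc (sum-ones n)

-- Without fixed points every orbit has three elements, exactly one of which is the least of its orbit.
order3-fixed-point : ∀ {n} (f : Fin n → Fin n) → (∀ i → f (f (f i)) ≡ i) → ¬ (3 ℕ.∣ n) →
  ∃ λ i → f i ≡ i
order3-fixed-point {n} f f³ 3∤n with Fin.any? (λ i → f i Fin.≟ i)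
... | yes fixed = fixed
... | no ¬fixed = contradiction (divides S n≡S*3) 3∤n
  where
  open ≡-Reasoning
  isMin : Fin n → ℕ
  isMin i = lt (toℕ i) (toℕ (f i)) ℕ.* lt (toℕ i) (toℕ (f (f i)))
  S = ΣN.sum isMin
  π : Permutation′ n
  π = permutation f (f ∘ f) f³ f³
  one : ∀ i → 1 ≡ isMin i ℕ.+ (isMin (f i) ℕ.+ isMin (f (f i)))
  one i rewrite f³ i = sym (least-count (toℕ i) (toℕ (f i)) (toℕ (f (f i)))
    (λ eq → ¬fixed (i , sym (Fin.toℕ-injective eq)))
    (λ eq → ¬fixed (f i , sym (Fin.toℕ-injective eq)))
    (λ eq → ¬fixed (i , trans (cong f (sym (Fin.toℕ-injective eq))) (f³ i))))
  n≡S*3 : n ≡ S ℕ.* 3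
  n≡S*3 = begin
    n ≡⟨ sum-ones n ⟨
    ΣN.sum {n} (λ _ → 1) ≡⟨ ΣN.sum-cong-≗ one ⟩
    ΣN.sum (λ i → isMin i ℕ.+ (isMin (f i) ℕ.+ isMin (f (f i)))) ≡⟨ ΣN.∑-distrib-+ isMin _ ⟩
    S ℕ.+ ΣN.sum (λ i → isMin (f i) ℕ.+ isMin (f (f i))) ≡⟨ cong (S ℕ.+_) (ΣN.∑-distrib-+ (isMin ∘ f) _) ⟩
    S ℕ.+ (ΣN.sum (isMin ∘ f) ℕ.+ ΣN.sum (isMin ∘ f ∘ f))
      ≡⟨ cong (S ℕ.+_) (cong₂ ℕ._+_ (ΣN.sum-permute isMin π)
           (trans (ΣN.sum-permute isMin π) (ΣN.sum-permute (isMin ∘ f) π))) ⟨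
    S ℕ.+ (S ℕ.+ S) ≡⟨ cong (λ z → S ℕ.+ (S ℕ.+ z)) (ℕ.+-identityʳ S) ⟨
    3 ℕ.* S ≡⟨ ℕ.*-comm 3 S ⟩
    S ℕ.* 3 ∎

-- Polynomial identities with integer coefficients

module IntegerCoefficients (R : CommutativeRing 0ℓ 0ℓ) where
  open CommutativeRing R renaming (refl to ≈-refl; sym to ≈-sym; trans to ≈-trans)
  open Algebra.Properties.Ring ring
  open Algebra.Properties.Semiring.Mult.TCOptimised semiring public renaming (_×_ to _×ₙ_)
  open import Relation.Binary.Reasoning.Setoid setoid

  -- With the optimised multiple, `ι (+ 1)` and `ι -[1+ 0 ]` reduce to `1#` and `- 1#`, so constants
  -- of the solver agree definitionally with the literals of the ring.
  ι : ℤ → Carrier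
  ι (+ n)    = n ×ₙ 1#
  ι -[1+ n ] = - (suc n ×ₙ 1#)

  ι-⊖ : ∀ m n → ι (m ⊖ n) ≈ m ×ₙ 1# + - (n ×ₙ 1#)
  ι-⊖ m       zero    = ≈-sym (≈-trans (+-congˡ -0#≈0#) (+-identityʳ _))
  ι-⊖ zero    (suc n) = ≈-sym (+-identityˡ _)
  ι-⊖ (suc m) (suc n) = begin
    ι (suc m ⊖ suc n)                          ≡⟨ cong ι (ℤ.[1+m]⊖[1+n]≡m⊖n m n) ⟩
    ι (m ⊖ n)                                  ≈⟨ ι-⊖ m n ⟩
    a + - b                                    ≈⟨ +-congʳ (xyx⁻¹≈y 1# a) ⟨
    1# + a + - 1# + - b                        ≈⟨ +-assoc _ _ _ ⟩
    1# + a + (- 1# + - b)                      ≈⟨ +-congˡ (-‿+-comm 1# b) ⟩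
    1# + a + - (1# + b)                        ≈⟨ +-cong (1+× m 1#) (-‿cong (1+× n 1#)) ⟨
    suc m ×ₙ 1# + - (suc n ×ₙ 1#)              ∎
    where
    a = m ×ₙ 1#
    b = n ×ₙ 1#

  ι-neg : ∀ i → ι (ℤ.- i) ≈ - ι i
  ι-neg (+ zero)  = ≈-sym -0#≈0#
  ι-neg (+ suc n) = ≈-refl
  ι-neg -[1+ n ]  = ≈-sym (-‿involutive _)

  ι-+ : ∀ i j → ι (i ℤ.+ j) ≈ ι i + ι j
  ι-+ (+ m)    (+ n)    = ×-homo-+ 1# m n
  ι-+ (+ m)    -[1+ n ] = ι-⊖ m (suc n)
  ι-+ -[1+ m ] (+ n)    = ≈-trans (ι-⊖ n (suc m)) (+-comm _ _)
  ι-+ -[1+ m ] -[1+ n ] = begin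
    - (suc (suc (m ℕ.+ n)) ×ₙ 1#)      ≡⟨ cong (λ k → - (suc k ×ₙ 1#)) (ℕ.+-suc m n) ⟨
    - ((suc m ℕ.+ suc n) ×ₙ 1#)        ≈⟨ -‿cong (×-homo-+ 1# (suc m) (suc n)) ⟩
    - (suc m ×ₙ 1# + suc n ×ₙ 1#)      ≈⟨ -‿+-comm _ _ ⟨
    - (suc m ×ₙ 1#) + - (suc n ×ₙ 1#)  ∎

  ι-*⁺ : ∀ m j → ι (+ m ℤ.* j) ≈ ι (+ m) * ι j
  ι-*⁺ m (+ n)    = begin
    ι (+ m ℤ.* + n)  ≡⟨ cong ι (ℤ.pos-* m n) ⟨
    ι (+ (m ℕ.* n))  ≈⟨ ×1-homo-* m n ⟩
    ι (+ m) * ι (+ n) ∎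
  ι-*⁺ m -[1+ n ] = begin
    ι (+ m ℤ.* -[1+ n ])        ≡⟨ cong ι (ℤ.neg-distribʳ-* (+ m) (+ suc n)) ⟨
    ι (ℤ.- (+ m ℤ.* + suc n))   ≈⟨ ι-neg (+ m ℤ.* + suc n) ⟩
    - ι (+ m ℤ.* + suc n)       ≈⟨ -‿cong (ι-*⁺ m (+ suc n)) ⟩
    - (ι (+ m) * ι (+ suc n))   ≈⟨ -‿distribʳ-* _ _ ⟩
    ι (+ m) * - ι (+ suc n)     ∎

  ι-* : ∀ i j → ι (i ℤ.* j) ≈ ι i * ι j
  ι-* (+ m)    j = ι-*⁺ m j
  ι-* -[1+ m ] j = begin
    ι (-[1+ m ] ℤ.* j)          ≡⟨ cong ι (ℤ.neg-distribˡ-* (+ suc m) j) ⟨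
    ι (ℤ.- (+ suc m ℤ.* j))     ≈⟨ ι-neg (+ suc m ℤ.* j) ⟩
    - ι (+ suc m ℤ.* j)         ≈⟨ -‿cong (ι-*⁺ (suc m) j) ⟩
    - (ι (+ suc m) * ι j)       ≈⟨ -‿distribˡ-* _ _ ⟩
    - ι (+ suc m) * ι j         ∎

  morphism : CommutativeRing.rawRing ℤ.+-*-commutativeRing -Raw-AlmostCommutative⟶ fromCommutativeRing R
  morphism = record
    { ⟦_⟧    = ι
    ; +-homo = ι-+
    ; *-homo = ι-*
    ; -‿homo = ι-neg
    ; 0-homo = ≈-refl
    ; 1-homo = ≈-refl
    }

  ι-≟ : ∀ i j → Maybe (ι i ≈ ι j)
  ι-≟ i j = Maybe.map (reflexive ∘ cong ι) (dec⇒maybe (i ℤ.≟ j))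

  open Algebra.Solver.Ring (CommutativeRing.rawRing ℤ.+-*-commutativeRing) (fromCommutativeRing R) morphism ι-≟
    public using (Polynomial; solve; _:=_; _:+_; _:*_; _:-_; :-_; con)

-- Integer Gram determinants and the finite check of sign patterns

∀Bool? : {P : Bool → Set} → (∀ b → Dec (P b)) → Dec (∀ b → P b)
∀Bool? P? = map′ (λ { (pt , pf) true → pt ; (pt , pf) false → pf }) (λ p → p true , p false) (P? true ×-dec P? false)

-- An element with off-diagonal entries b, c has type true or false according to B(D, ·) = 1 or −1. Then 3bc = norm,
-- and 3(bc′ + cb′) = pairing for two elements with B = sign; the factor 3 clears denominators.
sign : Bool → ℤ
sign true  = + 1
sign false = -[1+ 0 ]

norm : Bool → ℤ
norm true  = -[1+ 1 ]
norm false = + 0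

pairing : Bool → Bool → Bool → ℤ
pairing true  true  s = + 2 ℤ.- + 3 ℤ.* sign s
pairing false false s = + 3 ℤ.* (+ 2 ℤ.- sign s)
pairing _     _     s = ℤ.- (+ 3 ℤ.* sign s)

-- Three vectors with values xᵢ of a quadratic form and values hᵢⱼ of its polar form have a Gram
-- matrix with diagonal 2xᵢ and other entries hᵢⱼ. Its determinant is twice this integer.
halfGram : (x₁ x₂ x₃ h₁₂ h₁₃ h₂₃ : ℤ) → ℤ
halfGram x₁ x₂ x₃ h₁₂ h₁₃ h₂₃ =
  + 4 ℤ.* (x₁ ℤ.* x₂ ℤ.* x₃) ℤ.+ h₁₂ ℤ.* h₁₃ ℤ.* h₂₃ ℤ.-
    (x₁ ℤ.* h₂₃ ℤ.* h₂₃ ℤ.+ x₂ ℤ.* h₁₃ ℤ.* h₁₃ ℤ.+ x₃ ℤ.* h₁₂ ℤ.* h₁₂)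

tripleGram : (τ₁ τ₂ τ₃ s₁₂ s₁₃ s₂₃ : Bool) → ℤ
tripleGram τ₁ τ₂ τ₃ s₁₂ s₁₃ s₂₃ =
  halfGram (norm τ₁) (norm τ₂) (norm τ₃) (pairing τ₁ τ₂ s₁₂) (pairing τ₁ τ₃ s₁₃) (pairing τ₂ τ₃ s₂₃)

Compatible : (τ₁ τ₂ τ₃ s₁₂ s₁₃ s₂₃ : Bool) → Set
Compatible τ₁ τ₂ τ₃ s₁₂ s₁₃ s₂₃ = + 5 ℤ.∣ tripleGram τ₁ τ₂ τ₃ s₁₂ s₁₃ s₂₃

compatible? : ∀ τ₁ τ₂ τ₃ s₁₂ s₁₃ s₂₃ → Dec (Compatible τ₁ τ₂ τ₃ s₁₂ s₁₃ s₂₃)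
compatible? τ₁ τ₂ τ₃ s₁₂ s₁₃ s₂₃ = + 5 ℤ.∣? tripleGram τ₁ τ₂ τ₃ s₁₂ s₁₃ s₂₃

-- 3645 = 5 · 3⁶ and 729 = 3⁶
tripleGram-divides : ∀ τ₁ τ₂ τ₃ s₁₂ s₁₃ s₂₃ → let N = tripleGram τ₁ τ₂ τ₃ s₁₂ s₁₃ s₂₃ in
  N ℤ.∣ + 3645 × (¬ (+ 5 ℤ.∣ N) → N ℤ.∣ + 729)
tripleGram-divides = from-yes (∀Bool? λ τ₁ → ∀Bool? λ τ₂ → ∀Bool? λ τ₃ → ∀Bool? λ s₁₂ → ∀Bool? λ s₁₃ → ∀Bool? λ s₂₃ →
  let N = tripleGram τ₁ τ₂ τ₃ s₁₂ s₁₃ s₂₃ in (N ℤ.∣? + 3645) ×-dec (¬? (+ 5 ℤ.∣? N) →-dec (N ℤ.∣? + 729)))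

-- Five types and ten signs give 2¹⁵ patterns. The quantifiers are interleaved with the tests, so
-- that an incompatible triple cuts off its branch before the next vector is enumerated.
no-compatible-quintuple : ∀ a b c ab ac bc → Compatible a b c ab ac bc →
  ∀ d ad bd cd → Compatible a b d ab ad bd → Compatible a c d ac ad cd → Compatible b c d bc bd cd →
  ∀ e ae be ce de → Compatible a b e ab ae be → Compatible a c e ac ae ce → Compatible b c e bc be ce →
    Compatible a d e ad ae de → Compatible b d e bd be de → ¬ Compatible c d e cd ce de
no-compatible-quintuple = from-yes
  (∀Bool? λ a → ∀Bool? λ b → ∀Bool? λ c → ∀Bool? λ ab → ∀Bool? λ ac → ∀Bool? λ bc → compatible? a b c ab ac bc →-dec
  (∀Bool? λ d → ∀Bool? λ ad → ∀Bool? λ bd → ∀Bool? λ cd → compatible? a b d ab ad bd →-dec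
    (compatible? a c d ac ad cd →-dec (compatible? b c d bc bd cd →-dec
  (∀Bool? λ e → ∀Bool? λ ae → ∀Bool? λ be → ∀Bool? λ ce → ∀Bool? λ de → compatible? a b e ab ae be →-dec
    (compatible? a c e ac ae ce →-dec (compatible? b c e bc be ce →-dec (compatible? a d e ad ae de →-dec
    (compatible? b d e bd be de →-dec ¬? (compatible? c d e cd ce de))))))))))

-- Characteristic and sixth roots of unity of a finite field

module FieldTheory {q : ℕ} (K : FiniteField q) where
  open FiniteField K
  open ≡-Reasoning

  ring : CommutativeRing 0ℓ 0ℓ
  ring = record { isCommutativeRing = isCommutativeRing }

  open IntegerCoefficients ring public
  open CommutativeRing ring public
    using (+-identityʳ; *-identityˡ; zeroˡ; zeroʳ; -‿inverseʳ; +-commutativeMonoid)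

  open Inverse enumeration renaming (to to element; from to index)
    using (strictlyInverseˡ; strictlyInverseʳ)

  infix 4 _≟_
  _≟_ : DecidableEquality Carrier
  _≟_ = via-injection (↔⇒↣ (↔-sym enumeration)) Fin._≟_

  -- Proof by certificate: the hypothesis p = q enters with the explicit multiplier k, and what
  -- remains is an identity valid in every commutative ring, which the solver closes.
  combine₁ : ∀ {l r} k {p q} → p ≡ q → l ≡ r + k * (p + - q) → l ≡ r
  combine₁ {l} {r} k {p} refl eq = trans eq (solve 3 (λ r k p → r :+ k :* (p :- p) := r) refl r k p)

  combine₂ : ∀ {l r} k {p q} k′ {p′ q′} → p ≡ q → p′ ≡ q′ →
    l ≡ r + k * (p + - q) + k′ * (p′ + - q′) → l ≡ r
  combine₂ k k′ eq eq′ = combine₁ k eq ∘ combine₁ k′ eq′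

  combine₃ : ∀ {l r} k {p q} k′ {p′ q′} k″ {p″ q″} → p ≡ q → p′ ≡ q′ → p″ ≡ q″ →
    l ≡ r + k * (p + - q) + k′ * (p′ + - q′) + k″ * (p″ + - q″) → l ≡ r
  combine₃ k k′ k″ eq eq′ eq″ = combine₂ k k′ eq eq′ ∘ combine₁ k″ eq″

  x-y≡0⇒x≡y : ∀ {x y} → x + - y ≡ 0# → x ≡ y
  x-y≡0⇒x≡y {x} {y} eq = combine₁ 1# eq (solve 2 (λ x y → x := y :+ con (+ 1) :* (x :- y :- con (+ 0))) refl x y)

  *-nonzero-cancel : ∀ {x y} → x ≢ 0# → x * y ≡ 0# → y ≡ 0#
  *-nonzero-cancel {x} {y} x≢0 xy≡0 with x⁻¹ , inv ← inverse x x≢0 =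
    combine₂ x⁻¹ (- y) xy≡0 inv (solve 3 (λ x x⁻¹ y →
      y := con (+ 0) :+ x⁻¹ :* (x :* y :- con (+ 0)) :+ (:- y) :* (x :* x⁻¹ :- con (+ 1))) refl x x⁻¹ y)

  zero-product : ∀ {x y} → x * y ≡ 0# → x ≡ 0# ⊎ y ≡ 0#
  zero-product {x} eq with x ≟ 0#
  ... | yes x≡0 = inj₁ x≡0
  ... | no  x≢0 = inj₂ (*-nonzero-cancel x≢0 eq)

  *-nonzero : ∀ {x y} → x ≢ 0# → y ≢ 0# → x * y ≢ 0#
  *-nonzero x≢0 y≢0 = y≢0 ∘ *-nonzero-cancel x≢0

  1≢0 : 1# ≢ 0#
  1≢0 = 0≢1 ∘ sym

  module ΣK = CMSum +-commutativeMonoid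

  sum-const-1 : ∀ n → ΣK.sum {n} (λ _ → 1#) ≡ ι (+ n)
  sum-const-1 zero    = refl
  sum-const-1 (suc n) = trans (cong (_+_ 1#) (sum-const-1 n)) (sym (1+× n 1#))

  -- Translation by 1 permutes K, so ∑ x = ∑ (x + 1).
  q≡0 : ι (+ q) ≡ 0#
  q≡0 = combine₁ (- 1#) total (solve 2 (λ s n → n := con (+ 0) :+ (:- con (+ 1)) :* (s :- (s :+ n))) refl S (ι (+ q)))
    where
    S = ΣK.sum element
    shift : Permutation′ q
    shift = permutation (λ i → index (element i + 1#)) (λ i → index (element i + - 1#))
      (λ i → trans (cong (λ x → index (x + 1#)) (strictlyInverseˡ _))
        (trans (cong index (solve 1 (λ x → x :- con (+ 1) :+ con (+ 1) := x) refl (element i))) (strictlyInverseʳ i)))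
      (λ i → trans (cong (λ x → index (x + - 1#)) (strictlyInverseˡ _))
        (trans (cong index (solve 1 (λ x → x :+ con (+ 1) :- con (+ 1) := x) refl (element i))) (strictlyInverseʳ i)))
    total : S ≡ S + ι (+ q)
    total = begin
      S ≡⟨ ΣK.sum-permute element shift ⟩
      ΣK.sum (λ i → element (index (element i + 1#))) ≡⟨ ΣK.sum-cong-≗ (λ i → strictlyInverseˡ (element i + 1#)) ⟩
      ΣK.sum (λ i → element i + 1#) ≡⟨ ΣK.∑-distrib-+ element _ ⟩
      S + ΣK.sum {q} (λ _ → 1#) ≡⟨ cong (_+_ S) (sum-const-1 q) ⟩
      S + ι (+ q) ∎

  prime-power≡0 : ∀ p e → ι (+ (p ℕ.^ e)) ≡ 0# → ι (+ p) ≡ 0#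
  prime-power≡0 p zero    eq = contradiction eq 1≢0
  prime-power≡0 p (suc e) eq with zero-product (trans (sym (×1-homo-* p (p ℕ.^ e))) eq)
  ... | inj₁ p≡0 = p≡0
  ... | inj₂ p^e≡0 = prime-power≡0 p e p^e≡0

  ι-remainder : ∀ m n .{{_ : ℕ.NonZero n}} → ι (+ n) ≡ 0# → ι (+ m) ≡ ι (+ (m % n))
  ι-remainder m n n≡0 = begin
    ι (+ m)                                   ≡⟨ cong (ι ∘ +_) (m≡m%n+[m/n]*n m n) ⟩
    ι (+ (m % n ℕ.+ m / n ℕ.* n))             ≡⟨ ×-homo-+ 1# (m % n) (m / n ℕ.* n) ⟩
    ι (+ (m % n)) + ι (+ (m / n ℕ.* n))       ≡⟨ cong (_+_ (ι (+ (m % n)))) (×1-homo-* (m / n) n) ⟩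
    ι (+ (m % n)) + ι (+ (m / n)) * ι (+ n)   ≡⟨ cong (λ z → ι (+ (m % n)) + ι (+ (m / n)) * z) n≡0 ⟩
    ι (+ (m % n)) + ι (+ (m / n)) * 0#        ≡⟨ cong (_+_ (ι (+ (m % n)))) (zeroʳ _) ⟩
    ι (+ (m % n)) + 0#                        ≡⟨ +-identityʳ _ ⟩
    ι (+ (m % n))                             ∎

  3≢0 : q % 3 ≡ 1 → ι (+ 3) ≢ 0#
  3≢0 q%3≡1 3≡0 = 1≢0 (begin
    1#            ≡⟨ cong (ι ∘ +_) q%3≡1 ⟨
    ι (+ (q % 3)) ≡⟨ ι-remainder q 3 3≡0 ⟨
    ι (+ q)       ≡⟨ q≡0 ⟩
    0#            ∎)

  -- If 5 = 0, then p equals its remainder modulo 5 in K. Remainder 0 would make 5 divide the prime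
  -- p; for 2, 3 and 4 the Bézout relations 5 - 2·2, 2·3 - 5 and 5 - 4 yield 1 = 0.
  5≢0 : ∀ {p} → Prime p → ι (+ p) ≡ 0# → p ≢ 5 → ι (+ 5) ≢ 0#
  5≢0 {p} p-prime p≡0 p≢5 5≡0
    with p % 5 in eq | m%n<n p 5 | trans (sym (ι-remainder p 5 5≡0)) p≡0
  ... | 0 | _ | _ = case prime⇒irreducible p-prime (m%n≡0⇒n∣m p 5 eq) of λ where
    (inj₁ ())
    (inj₂ 5≡p) → p≢5 (sym 5≡p)
  ... | 1 | _ | r≡0 = 1≢0 r≡0
  ... | 2 | _ | r≡0 = 1≢0 (combine₂ 1# (- ι (+ 2)) 5≡0 r≡0 (solve 0
    (con (+ 1) := con (+ 0) :+ con (+ 1) :* (con (+ 5) :- con (+ 0)) :+ (:- con (+ 2)) :* (con (+ 2) :- con (+ 0))) refl))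
  ... | 3 | _ | r≡0 = 1≢0 (combine₂ (- 1#) (ι (+ 2)) 5≡0 r≡0 (solve 0
    (con (+ 1) := con (+ 0) :+ (:- con (+ 1)) :* (con (+ 5) :- con (+ 0)) :+ con (+ 2) :* (con (+ 3) :- con (+ 0))) refl))
  ... | 4 | _ | r≡0 = 1≢0 (combine₂ 1# (- 1#) 5≡0 r≡0 (solve 0
    (con (+ 1) := con (+ 0) :+ con (+ 1) :* (con (+ 5) :- con (+ 0)) :+ (:- con (+ 1)) :* (con (+ 4) :- con (+ 0))) refl))
  ... | suc (suc (suc (suc (suc _)))) | ℕ.s≤s (ℕ.s≤s (ℕ.s≤s (ℕ.s≤s (ℕ.s≤s ())))) | _

  -- The map x ↦ 1 / (1 - x) of order 3 on the projective line of q + 1 points; `zero` stands for ∞.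
  möbius∘element : Carrier → Fin (suc q)
  möbius∘element x with 1# + - x ≟ 0#
  ... | yes _      = zero
  ... | no 1-x≢0 = suc (index (proj₁ (inverse _ 1-x≢0)))

  möbius : Fin (suc q) → Fin (suc q)
  möbius zero    = suc (index 0#)
  möbius (suc i) = möbius∘element (element i)

  möbius-pole : möbius∘element 1# ≡ zero
  möbius-pole with 1# + - 1# ≟ 0#
  ... | yes _ = refl
  ... | no 1-1≢0 = contradiction (-‿inverseʳ 1#) 1-1≢0

  -- Inverses are unique, so the image can be computed with any solution y in place of the one that
  -- `inverse` selects.
  möbius-value : ∀ x y → (1# + - x) * y ≡ 1# → möbius∘element x ≡ suc (index y)
  möbius-value x y eq with 1# + - x ≟ 0#
  ... | yes 1-x≡0 = contradiction (trans (sym eq) (trans (cong (_* y) 1-x≡0) (zeroˡ y))) 1≢0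
  ... | no 1-x≢0 with z , inv ← inverse _ 1-x≢0 =
    cong (suc ∘ index) (combine₂ y (- z) inv eq
      (solve 3 (λ x y z → z := y :+ y :* ((con (+ 1) :- x) :* z :- con (+ 1)) :+ (:- z) :* ((con (+ 1) :- x) :* y :- con (+ 1)))
        refl x y z))

  möbius-index : ∀ x → möbius (suc (index x)) ≡ möbius∘element x
  möbius-index x = cong möbius∘element (strictlyInverseˡ x)

  möbius-order3-∞ : möbius (möbius (möbius zero)) ≡ zero
  möbius-order3-∞ = begin
    möbius (möbius (suc (index 0#))) ≡⟨ cong möbius (trans (möbius-index 0#) (möbius-value 0# 1#
      (solve 0 ((con (+ 1) :- con (+ 0)) :* con (+ 1) := con (+ 1)) refl))) ⟩
    möbius (suc (index 1#)) ≡⟨ trans (möbius-index 1#) möbius-pole ⟩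
    zero ∎

  -- The points ∞ ↦ 0 ↦ 1 ↦ ∞ form a cycle of their own. Away from it all denominators are nonzero
  -- and the cycle is x, 1/(1 - x), (x - 1)/x.
  möbius-order3-element : ∀ x → möbius (möbius (möbius∘element x)) ≡ suc (index x)
  möbius-order3-element x with x ≟ 1#
  ... | yes refl = trans (cong (möbius ∘ möbius) möbius-pole) (trans (möbius-index 0#) (möbius-value 0# 1#
      (solve 0 ((con (+ 1) :- con (+ 0)) :* con (+ 1) := con (+ 1)) refl)))
  ... | no x≢1 with y , inv ← inverse (1# + - x) (x≢1 ∘ sym ∘ x-y≡0⇒x≡y) | x ≟ 0#
  ... | yes refl = begin
    möbius (möbius (möbius∘element 0#)) ≡⟨ cong (möbius ∘ möbius) (möbius-value 0# 1#
      (solve 0 ((con (+ 1) :- con (+ 0)) :* con (+ 1) := con (+ 1)) refl)) ⟩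
    möbius (möbius (suc (index 1#))) ≡⟨ cong möbius (trans (möbius-index 1#) möbius-pole) ⟩
    suc (index 0#) ∎
  ... | no x≢0 with x⁻¹ , inv′ ← inverse x x≢0 = begin
    möbius (möbius (möbius∘element x)) ≡⟨ cong (möbius ∘ möbius) (möbius-value x y inv) ⟩
    möbius (möbius (suc (index y))) ≡⟨ cong möbius (trans (möbius-index y) (möbius-value y z
       (combine₂ x⁻¹ 1# inv inv′ (solve 3 (λ x y v → (con (+ 1) :- y) :* ((x :- con (+ 1)) :* v) :=
         con (+ 1) :+ v :* ((con (+ 1) :- x) :* y :- con (+ 1)) :+ con (+ 1) :* (x :* v :- con (+ 1))) refl x y x⁻¹)))) ⟩
    möbius (suc (index z)) ≡⟨ trans (möbius-index z) (möbius-value z x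
       (combine₁ (1# + - x) inv′ (solve 2 (λ x v → (con (+ 1) :- (x :- con (+ 1)) :* v) :* x :=
         con (+ 1) :+ (con (+ 1) :- x) :* (x :* v :- con (+ 1))) refl x x⁻¹))) ⟩
    suc (index x) ∎
    where z = (x + - 1#) * x⁻¹

  möbius-order3 : ∀ i → möbius (möbius (möbius i)) ≡ i
  möbius-order3 zero    = möbius-order3-∞
  möbius-order3 (suc i) = trans (möbius-order3-element (element i)) (cong suc (strictlyInverseʳ i))

  SixthRoot : Carrier → Set
  SixthRoot w = w * w ≡ w + - 1#

  -- A fixed point x satisfies (1 - x)x = 1, that is x² = x - 1. It cannot be ∞, which is sent to 0.
  sixth-root-of-unity : q % 3 ≡ 1 → ∃ SixthRoot
  sixth-root-of-unity q%3≡1 with order3-fixed-point möbius möbius-order3 3∤1+q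
    where
    3∤1+q : ¬ (3 ℕ.∣ suc q)
    3∤1+q 3∣1+q = case trans (sym (n∣m⇒m%n≡0 (suc q) 3 3∣1+q)) (begin
      suc q % 3                              ≡⟨ cong (λ n → suc n % 3) (m≡m%n+[m/n]*n q 3) ⟩
      suc (q % 3 ℕ.+ q / 3 ℕ.* 3) % 3        ≡⟨ [m+kn]%n≡m%n (suc (q % 3)) (q / 3) 3 ⟩
      suc (q % 3) % 3                        ≡⟨ cong (λ n → suc n % 3) q%3≡1 ⟩
      2                                      ∎) of λ ()
  ... | suc i , fixed with 1# + - element i ≟ 0#
  ... | yes _ = case fixed of λ ()
  ... | no 1-x≢0 with y , inv ← inverse _ 1-x≢0 = x , combine₁ (- 1#)
    (trans (cong ((1# + - x) *_) (trans (sym (cong element (Fin.suc-injective fixed))) (strictlyInverseˡ y))) inv)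
    (solve 1 (λ x → x :* x := x :- con (+ 1) :+ (:- con (+ 1)) :* ((con (+ 1) :- x) :* x :- con (+ 1))) refl x)
    where x = element i

-- Matrices of size two: adjugates, traces, conjugation and signs

module Matrices {q : ℕ} (K : FiniteField q) where
  open FiniteField K
  open FieldTheory K
  open PSL2 K
  open Mat
  open ≡-Reasoning

  mat-≡ : ∀ {a₁ a₂ b₁ b₂ c₁ c₂ d₁ d₂} → a₁ ≡ a₂ → b₁ ≡ b₂ → c₁ ≡ c₂ → d₁ ≡ d₂ →
    mat a₁ b₁ c₁ d₁ ≡ mat a₂ b₂ c₂ d₂
  mat-≡ refl refl refl refl = refl

  tr : Mat → Carrier
  tr x = a x + d x

  ·-assoc : ∀ x y z → (x · y) · z ≡ x · (y · z)
  ·-assoc (mat a b c d) (mat a′ b′ c′ d′) (mat a″ b″ c″ d″) =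
    mat-≡ (entry a b a″ c″) (entry a b b″ d″) (entry c d a″ c″) (entry c d b″ d″)
    where
    entry : ∀ a b a″ c″ → (a * a′ + b * c′) * a″ + (a * b′ + b * d′) * c″ ≡
      a * (a′ * a″ + b′ * c″) + b * (c′ * a″ + d′ * c″)
    entry a b a″ c″ = solve 8 (λ a b a′ b′ c′ d′ a″ c″ →
      (a :* a′ :+ b :* c′) :* a″ :+ (a :* b′ :+ b :* d′) :* c″ :=
      a :* (a′ :* a″ :+ b′ :* c″) :+ b :* (c′ :* a″ :+ d′ :* c″)) refl a b a′ b′ c′ d′ a″ c″

  ·-identityˡ : ∀ x → I · x ≡ x
  ·-identityˡ (mat a b c d) = mat-≡ (top a c) (top b d) (bottom a c) (bottom b d)
    where
    top : ∀ a c → 1# * a + 0# * c ≡ a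
    top = solve 2 (λ a c → con (+ 1) :* a :+ con (+ 0) :* c := a) refl
    bottom : ∀ a c → 0# * a + 1# * c ≡ c
    bottom = solve 2 (λ a c → con (+ 0) :* a :+ con (+ 1) :* c := c) refl

  ·-identityʳ : ∀ x → x · I ≡ x
  ·-identityʳ (mat a b c d) = mat-≡ (left a b) (right a b) (left c d) (right c d)
    where
    left : ∀ a b → a * 1# + b * 0# ≡ a
    left = solve 2 (λ a b → a :* con (+ 1) :+ b :* con (+ 0) := a) refl
    right : ∀ a b → a * 0# + b * 1# ≡ b
    right = solve 2 (λ a b → a :* con (+ 0) :+ b :* con (+ 1) := b) refl

  adj-· : ∀ x y → adj (x · y) ≡ adj y · adj x
  adj-· (mat a b c d) (mat a′ b′ c′ d′) = mat-≡
    (solve 4 (λ c d b′ d′ → c :* b′ :+ d :* d′ := d′ :* d :+ (:- b′) :* (:- c)) refl c d b′ d′)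
    (solve 4 (λ a b b′ d′ → :- (a :* b′ :+ b :* d′) := d′ :* (:- b) :+ (:- b′) :* a) refl a b b′ d′)
    (solve 4 (λ c d a′ c′ → :- (c :* a′ :+ d :* c′) := (:- c′) :* d :+ a′ :* (:- c)) refl c d a′ c′)
    (solve 4 (λ a b a′ c′ → a :* a′ :+ b :* c′ := (:- c′) :* (:- b) :+ a′ :* a) refl a b a′ c′)

  -‿involutive : ∀ x → - - x ≡ x
  -‿involutive = solve 1 (λ x → :- (:- x) := x) refl

  adj-involutive : ∀ x → adj (adj x) ≡ x
  adj-involutive (mat a b c d) = mat-≡ refl (-‿involutive b) (-‿involutive c) refl

  negM-involutive : ∀ x → negM (negM x) ≡ x
  negM-involutive (mat a b c d) = mat-≡ (-‿involutive a) (-‿involutive b) (-‿involutive c) (-‿involutive d)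

  negM-·ˡ : ∀ x y → negM x · y ≡ negM (x · y)
  negM-·ˡ (mat a b c d) (mat a′ b′ c′ d′) = mat-≡ (entry a b a′ c′) (entry a b b′ d′) (entry c d a′ c′) (entry c d b′ d′)
    where
    entry : ∀ a b a′ c′ → (- a) * a′ + (- b) * c′ ≡ - (a * a′ + b * c′)
    entry = solve 4 (λ a b a′ c′ → (:- a) :* a′ :+ (:- b) :* c′ := :- (a :* a′ :+ b :* c′)) refl

  negM-·ʳ : ∀ x y → x · negM y ≡ negM (x · y)
  negM-·ʳ (mat a b c d) (mat a′ b′ c′ d′) = mat-≡ (entry a b a′ c′) (entry a b b′ d′) (entry c d a′ c′) (entry c d b′ d′)
    where
    entry : ∀ a b a′ c′ → a * (- a′) + b * (- c′) ≡ - (a * a′ + b * c′)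
    entry = solve 4 (λ a b a′ c′ → a :* (:- a′) :+ b :* (:- c′) := :- (a :* a′ :+ b :* c′)) refl

  tr-comm : ∀ x y → tr (x · y) ≡ tr (y · x)
  tr-comm (mat a b c d) (mat a′ b′ c′ d′) = solve 8 (λ a b c d a′ b′ c′ d′ →
    (a :* a′ :+ b :* c′) :+ (c :* b′ :+ d :* d′) := (a′ :* a :+ b′ :* c) :+ (c′ :* b :+ d′ :* d))
    refl a b c d a′ b′ c′ d′

  tr-negM : ∀ x → tr (negM x) ≡ - tr x
  tr-negM (mat a b c d) = solve 2 (λ a d → (:- a) :+ (:- d) := :- (a :+ d)) refl a d

  tr-adj : ∀ x → tr (adj x) ≡ tr x
  tr-adj (mat a b c d) = solve 2 (λ a d → d :+ a := a :+ d) refl a d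

  det-· : ∀ x y → det (x · y) ≡ det x * det y
  det-· (mat a b c d) (mat a′ b′ c′ d′) = solve 8 (λ a b c d a′ b′ c′ d′ →
    (a :* a′ :+ b :* c′) :* (c :* b′ :+ d :* d′) :- (a :* b′ :+ b :* d′) :* (c :* a′ :+ d :* c′) :=
    (a :* d :- b :* c) :* (a′ :* d′ :- b′ :* c′)) refl a b c d a′ b′ c′ d′

  SL-· : ∀ {x y} → SL x → SL y → SL (x · y)
  SL-· {x} {y} detx dety = begin
    det (x · y)   ≡⟨ det-· x y ⟩
    det x * det y ≡⟨ cong₂ _*_ detx dety ⟩
    1# * 1#       ≡⟨ *-identityˡ 1# ⟩
    1#            ∎

  SL-adj : ∀ {x} → SL x → SL (adj x)
  SL-adj {mat a b c d} = trans
    (solve 4 (λ a b c d → d :* a :- (:- b) :* (:- c) := a :* d :- b :* c) refl a b c d)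

  SL-negM : ∀ {x} → SL x → SL (negM x)
  SL-negM {mat a b c d} = trans
    (solve 4 (λ a b c d → (:- a) :* (:- d) :- (:- b) :* (:- c) := a :* d :- b :* c) refl a b c d)

  SL-I : SL I
  SL-I = solve 0 (con (+ 1) :* con (+ 1) :- con (+ 0) :* con (+ 0) := con (+ 1)) refl

  adj-inverseˡ : ∀ {x} → SL x → adj x · x ≡ I
  adj-inverseˡ {mat a b c d} detx = mat-≡
    (trans (solve 4 (λ a b c d → d :* a :+ (:- b) :* c := a :* d :- b :* c) refl a b c d) detx)
    (solve 2 (λ b d → d :* b :+ (:- b) :* d := con (+ 0)) refl b d)
    (solve 2 (λ a c → (:- c) :* a :+ a :* c := con (+ 0)) refl a c)
    (trans (solve 4 (λ a b c d → (:- c) :* b :+ a :* d := a :* d :- b :* c) refl a b c d) detx)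

  adj-inverseʳ : ∀ {x} → SL x → x · adj x ≡ I
  adj-inverseʳ {x} detx = subst (λ y → y · adj x ≡ I) (adj-involutive x) (adj-inverseˡ (SL-adj detx))

  ·-adj-cancelˡ : ∀ {x} y → SL x → x · (adj x · y) ≡ y
  ·-adj-cancelˡ {x} y detx = begin
    x · (adj x · y) ≡⟨ ·-assoc x (adj x) y ⟨
    (x · adj x) · y ≡⟨ cong (_· y) (adj-inverseʳ detx) ⟩
    I · y           ≡⟨ ·-identityˡ y ⟩
    y               ∎

  adj-·-cancelˡ : ∀ {x} y → SL x → adj x · (x · y) ≡ y
  adj-·-cancelˡ {x} y detx = subst (λ z → adj x · (z · y) ≡ y) (adj-involutive x) (·-adj-cancelˡ y (SL-adj detx))

  conj : Mat → Mat → Mat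
  conj x u = adj x · (u · x)

  tr-conj : ∀ {x} u → SL x → tr (conj x u) ≡ tr u
  tr-conj {x} u detx = begin
    tr (adj x · (u · x)) ≡⟨ tr-comm (adj x) (u · x) ⟩
    tr ((u · x) · adj x) ≡⟨ cong tr (·-assoc u x (adj x)) ⟩
    tr (u · (x · adj x)) ≡⟨ cong (λ z → tr (u · z)) (adj-inverseʳ detx) ⟩
    tr (u · I)           ≡⟨ cong tr (·-identityʳ u) ⟩
    tr u                 ∎

  conj-· : ∀ x y u → conj (x · y) u ≡ conj y (conj x u)
  conj-· x y u = begin
    adj (x · y) · (u · (x · y))       ≡⟨ cong₂ _·_ (adj-· x y) (sym (·-assoc u x y)) ⟩
    (adj y · adj x) · ((u · x) · y)   ≡⟨ ·-assoc (adj y) (adj x) _ ⟩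
    adj y · (adj x · ((u · x) · y))   ≡⟨ cong (adj y ·_) (·-assoc (adj x) (u · x) y) ⟨
    adj y · ((adj x · (u · x)) · y)   ∎

  conj-adj : ∀ {x} u → SL x → conj (adj x) (conj x u) ≡ u
  conj-adj {x} u detx = begin
    conj (adj x) (conj x u) ≡⟨ conj-· x (adj x) u ⟨
    conj (x · adj x) u      ≡⟨ cong (λ y → adj y · (u · y)) (adj-inverseʳ detx) ⟩
    adj I · (u · I)         ≡⟨ cong₂ _·_ (mat-≡ refl -0≡0 -0≡0 refl) (·-identityʳ u) ⟩
    I · u                   ≡⟨ ·-identityˡ u ⟩
    u                       ∎
    where
    -0≡0 : - 0# ≡ 0#
    -0≡0 = solve 0 (:- con (+ 0) := con (+ 0)) refl

  conj-negM : ∀ x u → conj x (negM u) ≡ negM (conj x u)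
  conj-negM x u = trans (cong (adj x ·_) (negM-·ˡ u x)) (negM-·ʳ (adj x) (u · x))

  SL-conj : ∀ {x u} → SL x → SL u → SL (conj x u)
  SL-conj detx detu = SL-· (SL-adj detx) (SL-· detu detx)

  ≈P-sym : ∀ {x y} → x ≈P y → y ≈P x
  ≈P-sym (inj₁ x≡y) = inj₁ (sym x≡y)
  ≈P-sym {x} {y} (inj₂ x≡-y) = inj₂ (trans (sym (negM-involutive y)) (cong negM (sym x≡-y)))

  ≈P-trans : ∀ {x y z} → x ≈P y → y ≈P z → x ≈P z
  ≈P-trans (inj₁ refl) y≈z = y≈z
  ≈P-trans (inj₂ refl) (inj₁ refl) = inj₂ refl
  ≈P-trans (inj₂ refl) (inj₂ refl) = inj₁ (negM-involutive _)

  ·-congˡ-≈P : ∀ x {y z} → y ≈P z → (x · y) ≈P (x · z)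
  ·-congˡ-≈P x (inj₁ refl) = inj₁ refl
  ·-congˡ-≈P x (inj₂ refl) = inj₂ (negM-·ʳ x _)

  ·-congʳ-≈P : ∀ x {y z} → y ≈P z → (y · x) ≈P (z · x)
  ·-congʳ-≈P x (inj₁ refl) = inj₁ refl
  ·-congʳ-≈P x (inj₂ refl) = inj₂ (negM-·ˡ _ x)

  adj-cong-≈P : ∀ {x y} → x ≈P y → adj x ≈P adj y
  adj-cong-≈P (inj₁ refl) = inj₁ refl
  adj-cong-≈P (inj₂ refl) = inj₂ refl

  TraceUnit : Mat → Set
  TraceUnit x = tr x ≡ 1# ⊎ tr x ≡ - 1#

  TraceUnit-≈P : ∀ {x y} → x ≈P y → TraceUnit x → TraceUnit y
  TraceUnit-≈P (inj₁ refl) = λ h → h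
  TraceUnit-≈P {x} {y} (inj₂ refl) (inj₁ eq) =
    inj₂ (trans (sym (-‿involutive _)) (cong -_ (trans (sym (tr-negM y)) eq)))
  TraceUnit-≈P {x} {y} (inj₂ refl) (inj₂ eq) =
    inj₁ (trans (sym (-‿involutive _)) (trans (cong -_ (trans (sym (tr-negM y)) eq)) (-‿involutive _)))

-- Elements of order three and their diagonalisation

module Order3Elements {q : ℕ} (K : FiniteField q)
  (3≢0 : FieldTheory.ι K (+ 3) ≢ FiniteField.0# K)
  (w : FiniteField.Carrier K) (w²≡w-1 : FieldTheory.SixthRoot K w)
  (t : PSL2.Mat K) (order3 : PSL2.Order3 K t) where
  open FiniteField K
  open FieldTheory K hiding (3≢0)
  open PSL2 K
  open Action t
  open Matrices K
  open ≡-Reasoning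

  -- The second root of z² - z + 1, and the inverse of w because w(1 - w) = 1.
  w̄ : Carrier
  w̄ = 1# + - w

  D : Mat
  D = mat w 0# 0# w̄

  w̄²≡w̄-1 : w̄ * w̄ ≡ w̄ + - 1#
  w̄²≡w̄-1 = combine₁ 1# w²≡w-1 (solve 1 (λ w → (con (+ 1) :- w) :* (con (+ 1) :- w) :=
    con (+ 1) :- w :- con (+ 1) :+ con (+ 1) :* (w :* w :- (w :- con (+ 1)))) refl w)

  w≢0 : w ≢ 0#
  w≢0 w≡0 = 1≢0 (combine₂ (1# + - w) 1# w≡0 w²≡w-1 (solve 1 (λ w → con (+ 1) := con (+ 0) :+
    (con (+ 1) :- w) :* (w :- con (+ 0)) :+ con (+ 1) :* (w :* w :- (w :- con (+ 1)))) refl w))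

  -- (2w − 1)² = −3
  w-w̄≢0 : w + - w̄ ≢ 0#
  w-w̄≢0 eq = 3≢0 (combine₂ (- (w + - w̄)) (ι (+ 4)) eq w²≡w-1 (solve 1 (λ w → let w̄ = con (+ 1) :- w in
    con (+ 3) := con (+ 0) :+ (:- (w :- w̄)) :* (w :- w̄ :- con (+ 0)) :+ con (+ 4) :* (w :* w :- (w :- con (+ 1)))) refl w))

  eigenbasis⇒conj≡D : ∀ {a b c d x₁ y₁ x₂ y₂} →
    a * x₁ + b * y₁ ≡ w * x₁ → c * x₁ + d * y₁ ≡ w * y₁ →
    a * x₂ + b * y₂ ≡ w̄ * x₂ → c * x₂ + d * y₂ ≡ w̄ * y₂ →
    x₁ * y₂ + - (x₂ * y₁) ≢ 0# →
    ∃ λ P → SL P × conj P (mat a b c d) ≡ D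
  eigenbasis⇒conj≡D {a} {b} {c} {d} {x₁} {y₁} {x₂} {y₂} eq₁ eq₂ eq₃ eq₄ δ≢0 with v , inv ← inverse _ δ≢0 =
    P , detP , (begin
      adj P · (mat a b c d · P) ≡⟨ cong (adj P ·_) uP≡PD ⟩
      adj P · (P · D)           ≡⟨ adj-·-cancelˡ D detP ⟩
      D                         ∎)
    where
    P : Mat
    -- Rescaling only the first eigenvector by the inverse determinant keeps both columns
    -- eigenvectors and gives determinant 1.
    P = mat (x₁ * v) x₂ (y₁ * v) y₂
    detP : SL P
    detP = trans (solve 5 (λ x₁ y₁ x₂ y₂ v →
      x₁ :* v :* y₂ :- x₂ :* (y₁ :* v) := (x₁ :* y₂ :- x₂ :* y₁) :* v) refl x₁ y₁ x₂ y₂ v) inv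
    first-column : ∀ {a b x y z} e → a * x + b * y ≡ w * z → a * (x * v) + b * (y * v) ≡ z * v * w + e * 0#
    first-column {a} {b} {x} {y} {z} e eq = combine₁ v eq (solve 8 (λ a b x y z e v w →
      a :* (x :* v) :+ b :* (y :* v) := z :* v :* w :+ e :* con (+ 0) :+ v :* (a :* x :+ b :* y :- w :* z))
      refl a b x y z e v w)
    second-column : ∀ {l z} e → l ≡ w̄ * z → l ≡ e * 0# + z * w̄
    second-column {l} {z} e eq = combine₁ 1# eq (solve 4 (λ l z e w̄ →
      l := e :* con (+ 0) :+ z :* w̄ :+ con (+ 1) :* (l :- w̄ :* z)) refl l z e w̄)
    uP≡PD : mat a b c d · P ≡ P · D
    uP≡PD = mat-≡ (first-column x₂ eq₁) (second-column (x₁ * v) eq₃) (first-column y₂ eq₂) (second-column (y₁ * v) eq₄)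

  -- The characteristic polynomial is z² - z + 1, with roots w and `w̄`. For a root z an eigenvector
  -- is (z - d, c) if c ≠ 0 and (b, z - a) if b ≠ 0; a diagonal matrix is D or D with its entries
  -- exchanged.
  diagonalise-trace-1 : ∀ u → SL u → tr u ≡ 1# → ∃ λ P → SL P × conj P u ≡ D
  diagonalise-trace-1 (mat a b c d) detu tru with c ≟ 0# | b ≟ 0#
  ... | no c≢0 | _ = eigenbasis⇒conj≡D (top w w²≡w-1) (bottom w) (top w̄ w̄²≡w̄-1) (bottom w̄)
    (λ δ≡0 → *-nonzero c≢0 w-w̄≢0 (trans (solve 4 (λ c d w w̄ →
      c :* (w :- w̄) := (w :- d) :* c :- (w̄ :- d) :* c) refl c d w w̄) δ≡0))
    where
    top : ∀ z → z * z ≡ z + - 1# → a * (z + - d) + b * c ≡ z * (z + - d)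
    top z z² = combine₃ z (- 1#) (- 1#) tru detu z² (solve 5 (λ a b c d z →
      a :* (z :- d) :+ b :* c := z :* (z :- d) :+ z :* (a :+ d :- con (+ 1)) :+
        (:- con (+ 1)) :* (a :* d :- b :* c :- con (+ 1)) :+ (:- con (+ 1)) :* (z :* z :- (z :- con (+ 1)))) refl a b c d z)
    bottom : ∀ z → c * (z + - d) + d * c ≡ z * c
    bottom = λ z → solve 3 (λ c d z → c :* (z :- d) :+ d :* c := z :* c) refl c d z
  ... | yes _ | no b≢0 = eigenbasis⇒conj≡D (top w) (bottom w w²≡w-1) (top w̄) (bottom w̄ w̄²≡w̄-1)
    (λ δ≡0 → *-nonzero b≢0 w-w̄≢0 (combine₁ (- 1#) δ≡0 (solve 4 (λ a b w w̄ →
      b :* (w :- w̄) := con (+ 0) :+ (:- con (+ 1)) :* (b :* (w̄ :- a) :- b :* (w :- a) :- con (+ 0))) refl a b w w̄)))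
    where
    bottom : ∀ z → z * z ≡ z + - 1# → c * b + d * (z + - a) ≡ z * (z + - a)
    bottom z z² = combine₃ z (- 1#) (- 1#) tru detu z² (solve 5 (λ a b c d z →
      c :* b :+ d :* (z :- a) := z :* (z :- a) :+ z :* (a :+ d :- con (+ 1)) :+
        (:- con (+ 1)) :* (a :* d :- b :* c :- con (+ 1)) :+ (:- con (+ 1)) :* (z :* z :- (z :- con (+ 1)))) refl a b c d z)
    top : ∀ z → a * b + b * (z + - a) ≡ z * b
    top = λ z → solve 3 (λ a b z → a :* b :+ b :* (z :- a) := z :* b) refl a b z
  ... | yes refl | yes refl with zero-product (eigenvalues a d detu tru)
    where
    eigenvalues : ∀ a d → a * d + - (0# * 0#) ≡ 1# → a + d ≡ 1# → (a + - w) * (a + - w̄) ≡ 0#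
    eigenvalues a d det≡1 tr≡1 = combine₃ (- 1#) a (- 1#) det≡1 tr≡1 w²≡w-1
        (solve 3 (λ a d w → (a :- w) :* (a :- (con (+ 1) :- w)) := con (+ 0) :+
          (:- con (+ 1)) :* (a :* d :- con (+ 0) :* con (+ 0) :- con (+ 1)) :+ a :* (a :+ d :- con (+ 1)) :+
          (:- con (+ 1)) :* (w :* w :- (w :- con (+ 1)))) refl a d w)
  ... | inj₁ a-w≡0 = eigenbasis⇒conj≡D {x₁ = 1#} {0#} {0#} {1#}
    (combine₁ 1# a-w≡0 (solve 2 (λ a w → a :* con (+ 1) :+ con (+ 0) :* con (+ 0) :=
      w :* con (+ 1) :+ con (+ 1) :* (a :- w :- con (+ 0))) refl a w))
    (solve 2 (λ d w → con (+ 0) :* con (+ 1) :+ d :* con (+ 0) := w :* con (+ 0)) refl d w)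
    (solve 2 (λ a w̄ → a :* con (+ 0) :+ con (+ 0) :* con (+ 1) := w̄ :* con (+ 0)) refl a w̄)
    (combine₂ (- 1#) 1# a-w≡0 tru (solve 3 (λ a d w → con (+ 0) :* con (+ 0) :+ d :* con (+ 1) :=
      (con (+ 1) :- w) :* con (+ 1) :+ (:- con (+ 1)) :* (a :- w :- con (+ 0)) :+ con (+ 1) :* (a :+ d :- con (+ 1))) refl a d w))
    (1≢0 ∘ trans (solve 0 (con (+ 1) := con (+ 1) :* con (+ 1) :- con (+ 0) :* con (+ 0)) refl))
  -- The diagonal entries are exchanged; the columns (0, 1) and (-1, 0) swap them back with
  -- determinant 1.
  ... | inj₂ a-w̄≡0 = eigenbasis⇒conj≡D {x₁ = 0#} {1#} { - 1# } {0#}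
    (solve 2 (λ a w → a :* con (+ 0) :+ con (+ 0) :* con (+ 1) := w :* con (+ 0)) refl a w)
    (combine₂ (- 1#) 1# a-w̄≡0 tru (solve 3 (λ a d w → con (+ 0) :* con (+ 0) :+ d :* con (+ 1) :=
      w :* con (+ 1) :+ (:- con (+ 1)) :* (a :- (con (+ 1) :- w) :- con (+ 0)) :+ con (+ 1) :* (a :+ d :- con (+ 1))) refl a d w))
    (combine₁ (- 1#) a-w̄≡0 (solve 2 (λ a w̄ → a :* (:- con (+ 1)) :+ con (+ 0) :* con (+ 0) :=
      w̄ :* (:- con (+ 1)) :+ (:- con (+ 1)) :* (a :- w̄ :- con (+ 0))) refl a w̄))
    (solve 2 (λ d w̄ → con (+ 0) :* (:- con (+ 1)) :+ d :* con (+ 0) := w̄ :* con (+ 0)) refl d w̄)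
    (1≢0 ∘ trans (solve 0 (con (+ 1) := con (+ 0) :* con (+ 0) :- (:- con (+ 1)) :* con (+ 1)) refl))

  conj-cong-≈P : ∀ x {u v} → u ≈P v → conj x u ≈P conj x v
  conj-cong-≈P x = ·-congˡ-≈P (adj x) ∘ ·-congʳ-≈P x

  diagonalise : ∀ u → SL u → TraceUnit u → ∃ λ P → SL P × conj P u ≈P D
  diagonalise u detu (inj₁ tru) = let P , detP , eq = diagonalise-trace-1 u detu tru in P , detP , inj₁ eq
  diagonalise u detu (inj₂ tru) =
    let P , detP , eq = diagonalise-trace-1 (negM u) (SL-negM detu)
          (trans (tr-negM u) (trans (cong -_ tru) (-‿involutive 1#)))
    in P , detP , ≈P-sym (inj₂ (trans (sym eq) (conj-negM P u)))

  TraceUnit-conjugate : ∀ {u v} → SL u → SL v → TraceUnit u → TraceUnit v → ∃ λ x → SL x × conj x u ≈P v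
  TraceUnit-conjugate {u} {v} detu detv tru trv =
    let P , detP , u≈D = diagonalise u detu tru
        R , detR , v≈D = diagonalise v detv trv
    in P · adj R , SL-· detP (SL-adj detR) ,
      subst (_≈P v) (sym (conj-· P (adj R) u))
        (≈P-trans (conj-cong-≈P (adj R) (≈P-trans u≈D (≈P-sym v≈D))) (inj₁ (conj-adj v detR)))

  scalar⇒≈P-I : ∀ {a d} → a * d + - (0# * 0#) ≡ 1# → a ≡ d → mat a 0# 0# d ≈P I
  scalar⇒≈P-I {a} detx refl with zero-product (difference-of-squares a detx)
    where
    difference-of-squares : ∀ a → a * a + - (0# * 0#) ≡ 1# → (a + - 1#) * (a + 1#) ≡ 0#
    difference-of-squares a eq = combine₁ 1# eq (solve 1 (λ a →
      (a :- con (+ 1)) :* (a :+ con (+ 1)) := con (+ 0) :+ con (+ 1) :* (a :* a :- con (+ 0) :* con (+ 0) :- con (+ 1))) refl a)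
  ... | inj₁ eq = inj₁ (mat-≡ a≡1 refl refl a≡1)
    where
    a≡1 : a ≡ 1#
    a≡1 = x-y≡0⇒x≡y eq
  ... | inj₂ eq = inj₂ (mat-≡ a≡-1 0≡-0 0≡-0 a≡-1)
    where
    a≡-1 : a ≡ - 1#
    a≡-1 = combine₁ 1# eq (solve 1 (λ a → a := (:- con (+ 1)) :+ con (+ 1) :* (a :+ con (+ 1) :- con (+ 0))) refl a)
    0≡-0 : 0# ≡ - 0#
    0≡-0 = solve 0 (con (+ 0) := :- con (+ 0)) refl

  -- If x² = s x⁻¹ with x ≠ ±1, then comparing entries (tr x + s) annihilates b, c and a - d.
  square≡inverse⇒trace : ∀ {x} s → SL x → ¬ (x ≈P I) →
    x · x ≡ mat (s * Mat.d x) (s * - Mat.b x) (s * - Mat.c x) (s * Mat.a x) → tr x ≡ - s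
  square≡inverse⇒trace {mat a b c d} s detx x≉I eq with a + d + s ≟ 0#
  ... | yes tr+s≡0 = combine₁ 1# tr+s≡0 (solve 3 (λ a d s →
    a :+ d := (:- s) :+ con (+ 1) :* (a :+ d :+ s :- con (+ 0))) refl a d s)
  ... | no tr+s≢0 = contradiction (subst (_≈P I) (sym diagonal) (scalar⇒≈P-I (trans (sym (cong det diagonal)) detx) a≡d)) x≉I
    where
    b≡0 : b ≡ 0#
    b≡0 = *-nonzero-cancel tr+s≢0 (combine₁ 1# (cong Mat.b eq) (solve 4 (λ a b d s →
      (a :+ d :+ s) :* b := con (+ 0) :+ con (+ 1) :* (a :* b :+ b :* d :- s :* (:- b))) refl a b d s))
    c≡0 : c ≡ 0#
    c≡0 = *-nonzero-cancel tr+s≢0 (combine₁ 1# (cong Mat.c eq) (solve 4 (λ a c d s →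
      (a :+ d :+ s) :* c := con (+ 0) :+ con (+ 1) :* (c :* a :+ d :* c :- s :* (:- c))) refl a c d s))
    a≡d : a ≡ d
    a≡d = x-y≡0⇒x≡y (*-nonzero-cancel tr+s≢0 (combine₂ 1# (- 1#) (cong Mat.a eq) (cong Mat.d eq) (solve 5 (λ a b c d s →
      (a :+ d :+ s) :* (a :- d) := con (+ 0) :+ con (+ 1) :* (a :* a :+ b :* c :- s :* d) :+
        (:- con (+ 1)) :* (c :* b :+ d :* d :- s :* a)) refl a b c d s)))
    diagonal : mat a b c d ≡ mat a 0# 0# d
    diagonal = mat-≡ refl b≡0 c≡0 refl

  t·t≈adj-t : (t · t) ≈P adj t
  t·t≈adj-t = subst₂ _≈P_ (trans (adj-·-cancelˡ (t · (t · I)) SLt) (cong (t ·_) (·-identityʳ t))) (·-identityʳ (adj t))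
    (·-congˡ-≈P (adj t) (proj₂ (proj₂ order3)))
    where SLt = proj₁ order3

  SL-t : SL t
  SL-t = proj₁ order3

  TraceUnit-t : TraceUnit t
  TraceUnit-t = [ (λ t²≡ → inj₂ (by-sign 1# id 1* t²≡))
                , (λ t²≡ → inj₁ (trans (by-sign (- 1#) -_ -1* t²≡) (-‿involutive 1#))) ]′ t·t≈adj-t
    where
    -- Both signs in t² = ±t⁻¹ are treated alike: `f` is the sign as it appears in the entries, `s`
    -- the same sign as a factor.
    by-sign : ∀ s (f : Carrier → Carrier) → (∀ x → f x ≡ s * x) →
      t · t ≡ mat (f (Mat.d t)) (f (- Mat.b t)) (f (- Mat.c t)) (f (Mat.a t)) → tr t ≡ - s
    by-sign s f f≡s* t²≡ = square≡inverse⇒trace s SL-t (proj₁ (proj₂ order3))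
      (trans t²≡ (mat-≡ (f≡s* _) (f≡s* _) (f≡s* _) (f≡s* _)))
    1* : ∀ x → x ≡ 1# * x
    1* x = sym (*-identityˡ x)
    -1* : ∀ x → - x ≡ - 1# * x
    -1* = solve 1 (λ x → :- x := (:- con (+ 1)) :* x) refl

  TraceUnit-adj : ∀ x → TraceUnit x → TraceUnit (adj x)
  TraceUnit-adj x = subst (λ z → z ≡ 1# ⊎ z ≡ - 1#) (sym (tr-adj x))

  TraceUnit-t·t : TraceUnit (t · t)
  TraceUnit-t·t = TraceUnit-≈P (≈P-sym t·t≈adj-t) (TraceUnit-adj t TraceUnit-t)

  -- The trace of ±I is ±2, and 2 = 1 or 2 = -1 would give 1 = 0 or 3 = 0.
  TraceUnit⇒≉I : ∀ {x} → TraceUnit x → ¬ (x ≈P I)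
  TraceUnit⇒≉I {x} tru x≈I = [ 1≢0 ∘ 2≡1⇒1≡0 , 3≢0 ∘ 2≡-1⇒3≡0 ]′ (TraceUnit-≈P x≈I tru)
    where
    2≡1⇒1≡0 : 1# + 1# ≡ 1# → 1# ≡ 0#
    2≡1⇒1≡0 eq = combine₁ 1# eq (solve 0 (con (+ 1) := con (+ 0) :+ con (+ 1) :* (con (+ 1) :+ con (+ 1) :- con (+ 1))) refl)
    2≡-1⇒3≡0 : 1# + 1# ≡ - 1# → ι (+ 3) ≡ 0#
    2≡-1⇒3≡0 eq = combine₁ 1# eq (solve 0 (con (+ 3) := con (+ 0) :+ con (+ 1) :* (con (+ 1) :+ con (+ 1) :- (:- con (+ 1)))) refl)

  power : Fin 3 → Mat
  power k = t ^M toℕ k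

  t^k-trace : ∀ k → power k ≡ I ⊎ TraceUnit (power k)
  t^k-trace zero             = inj₁ refl
  t^k-trace (suc zero)       = inj₂ (subst TraceUnit (sym (·-identityʳ t)) TraceUnit-t)
  t^k-trace (suc (suc zero)) = inj₂ (subst (λ z → TraceUnit (t · z)) (sym (·-identityʳ t)) TraceUnit-t·t)

  -- Commuting conjugates, towards faithfulness of the action

  commute-powerˡ : ∀ {x} n → x · t ≡ t · x → x · (t ^M n) ≡ (t ^M n) · x
  commute-powerˡ {x} zero    eq = trans (·-identityʳ x) (sym (·-identityˡ x))
  commute-powerˡ {x} (suc n) eq = begin
    x · (t · (t ^M n))   ≡⟨ ·-assoc x t _ ⟨
    (x · t) · (t ^M n)   ≡⟨ cong (_· (t ^M n)) eq ⟩
    (t · x) · (t ^M n)   ≡⟨ ·-assoc t x _ ⟩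
    t · (x · (t ^M n))   ≡⟨ cong (t ·_) (commute-powerˡ n eq) ⟩
    t · ((t ^M n) · x)   ≡⟨ ·-assoc t _ x ⟨
    (t · (t ^M n)) · x   ∎

  powers-commute : ∀ m n → (t ^M m) · (t ^M n) ≡ (t ^M n) · (t ^M m)
  powers-commute m n = commute-powerˡ n (sym (commute-powerˡ m refl))

  commute-≈P : ∀ {x y z} → x ≈P y → y · z ≡ z · y → x · z ≡ z · x
  commute-≈P (inj₁ refl) eq = eq
  commute-≈P {y = y} {z} (inj₂ refl) eq = trans (negM-·ˡ y z) (trans (cong negM eq) (sym (negM-·ʳ z y)))

  -- Signs are central, so representatives of elements of H commute exactly and not only up to sign.
  -- This allows comparing matrix entries below.
  InH-commute : ∀ {x y} → InH x → InH y → x · y ≡ y · x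
  InH-commute (i , x≈) (j , y≈) = commute-≈P x≈ (sym (commute-≈P y≈ (powers-commute (toℕ j) (toℕ i))))

  shear : Carrier → Mat
  shear k = mat 1# k 0# 1#

  SL-shear : ∀ k → SL (shear k)
  SL-shear = solve 1 (λ k → con (+ 1) :* con (+ 1) :- k :* con (+ 0) := con (+ 1)) refl

  conj-shear : ∀ k a b c d → conj (shear k) (mat a b c d) ≡ mat (a + - (k * c)) (b + k * (a + - d) + - (k * k * c)) c (k * c + d)
  conj-shear k a b c d = mat-≡
    (solve 5 (λ k a b c d → con (+ 1) :* (a :* con (+ 1) :+ b :* con (+ 0)) :+ (:- k) :* (c :* con (+ 1) :+ d :* con (+ 0)) :=
      a :- k :* c) refl k a b c d)
    (solve 5 (λ k a b c d → con (+ 1) :* (a :* k :+ b :* con (+ 1)) :+ (:- k) :* (c :* k :+ d :* con (+ 1)) :=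
      b :+ k :* (a :- d) :- k :* k :* c) refl k a b c d)
    (solve 5 (λ k a b c d → (:- con (+ 0)) :* (a :* con (+ 1) :+ b :* con (+ 0)) :+ con (+ 1) :* (c :* con (+ 1) :+ d :* con (+ 0)) :=
      c) refl k a b c d)
    (solve 5 (λ k a b c d → (:- con (+ 0)) :* (a :* k :+ b :* con (+ 1)) :+ con (+ 1) :* (c :* k :+ d :* con (+ 1)) :=
      k :* c :+ d) refl k a b c d)

  -- The upper right entry is left free because shears centralise every ± shear. The conclusion
  -- still determines the trace.
  shears-commute⇒scalar : ∀ {a b c d} → (∀ k → let u = mat a b c d in u · conj (shear k) u ≡ conj (shear k) u · u) →
    c ≡ 0# × a ≡ d
  shears-commute⇒scalar {a} {b} {c} {d} commute = c≡0 , x-y≡0⇒x≡y ([ id , id ]′ (zero-product a-d²≡0))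
    where
    u = mat a b c d
    commute′ : ∀ k → let v = mat (a + - (k * c)) (b + k * (a + - d) + - (k * k * c)) c (k * c + d) in u · v ≡ v · u
    commute′ k = subst (λ v → u · v ≡ v · u) (conj-shear k a b c d) (commute k)
    corner : ∀ k → k ≢ 0# → c * (a + - d + - (k * c)) ≡ 0#
    corner k k≢0 = *-nonzero-cancel k≢0 (combine₁ (- 1#) (cong Mat.a (commute′ k)) (solve 5 (λ a b c d k →
      k :* (c :* (a :- d :- k :* c)) := con (+ 0) :+ (:- con (+ 1)) :*
        (a :* (a :- k :* c) :+ b :* c :- ((a :- k :* c) :* a :+ (b :+ k :* (a :- d) :- k :* k :* c) :* c)))
      refl a b c d k))
    c≡0 : c ≡ 0#
    -- Subtracting the relations for k = 1 and k = w eliminates a - d and leaves (w - 1)c² = w²c².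
    c≡0 = [ id , id ]′ (zero-product (*-nonzero-cancel (*-nonzero w≢0 w≢0) (combine₃ 1# (- 1#) (c * c)
      (corner 1# 1≢0) (corner w w≢0) w²≡w-1 (solve 4 (λ a c d w → (w :* w) :* (c :* c) := con (+ 0) :+
        con (+ 1) :* (c :* (a :- d :- con (+ 1) :* c) :- con (+ 0)) :+
        (:- con (+ 1)) :* (c :* (a :- d :- w :* c) :- con (+ 0)) :+ (c :* c) :* (w :* w :- (w :- con (+ 1)))) refl a c d w))))
    a-d²≡0 : (a + - d) * (a + - d) ≡ 0#
    a-d²≡0 = combine₂ 1# (a + - d + - (ι (+ 2) * b)) (cong Mat.b (commute′ 1#)) c≡0 (solve 4 (λ a b c d →
      let v-a = a :- con (+ 1) :* c
          v-b = b :+ con (+ 1) :* (a :- d) :- con (+ 1) :* con (+ 1) :* c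
          v-d = con (+ 1) :* c :+ d
      in (a :- d) :* (a :- d) := con (+ 0) :+ con (+ 1) :* (a :* v-b :+ b :* v-d :- (v-a :* b :+ v-b :* d)) :+
        (a :- d :- con (+ 2) :* b) :* (c :- con (+ 0))) refl a b c d)

-- Agreement, faithfulness and point stabilisers of the coset action

AllPairs-lookup : ∀ {A : Set} {R : A → A → Set} {xs} → AllPairs R xs → ∀ {i j} → i Fin.< j → R (lookup xs i) (lookup xs j)
AllPairs-lookup (px ∷ _)  {zero}  {suc j} _         = All.lookup px (∈-lookup j)
AllPairs-lookup (_ ∷ pxs) {suc i} {suc j} (s≤s i<j) = AllPairs-lookup pxs i<j

classes-bound : ∀ {A : Set} {n} {R : A → A → Set} {P : A → Set} (class : ∀ {x} → P x → Fin n) →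
  (∀ {x y} (px : P x) (py : P y) → class px ≡ class py → R x y) →
  ∀ {xs} → All P xs → AllPairs (λ x y → ¬ R x y) xs → length xs ≤ n
classes-bound {n = n} class same {xs} pxs distinct with length xs ℕ.≤? n
... | yes ≤n = ≤n
... | no  ≰n =
  let i , j , i<j , eq = Fin.pigeonhole (ℕ.≰⇒> ≰n) (λ i → class (All.lookup pxs (∈-lookup {xs = xs} i)))
  in contradiction (same _ _ eq) (AllPairs-lookup distinct i<j)

module Permutations {q : ℕ} (K : FiniteField q)
  (3≢0 : FieldTheory.ι K (+ 3) ≢ FiniteField.0# K)
  (w : FiniteField.Carrier K) (w²≡w-1 : FieldTheory.SixthRoot K w)
  (t : PSL2.Mat K) (order3 : PSL2.Order3 K t) where
  open FiniteField K
  open FieldTheory K hiding (3≢0)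
  open PSL2 K
  open Action t
  open Matrices K
  open Order3Elements K 3≢0 w w²≡w-1 t order3
  open ≡-Reasoning

  -- Turns agreement at the coset xH into membership in H of a conjugate of g⁻¹h, whose trace does
  -- not depend on x.
  relative-position : ∀ g h x → adj (g · x) · (h · x) ≡ conj x (adj g · h)
  relative-position g h x = begin
    adj (g · x) · (h · x)       ≡⟨ cong (_· (h · x)) (adj-· g x) ⟩
    (adj x · adj g) · (h · x)   ≡⟨ ·-assoc (adj x) (adj g) _ ⟩
    adj x · (adj g · (h · x))   ≡⟨ cong (adj x ·_) (·-assoc (adj g) h x) ⟨
    adj x · ((adj g · h) · x)   ∎

  conj-I : ∀ {x} → SL x → conj x I ≡ I
  conj-I {x} detx = trans (cong (adj x ·_) (·-identityˡ x)) (adj-inverseˡ detx)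

  SL-adj-· : ∀ {g h} → SL g → SL h → SL (adj g · h)
  SL-adj-· detg = SL-· (SL-adj detg)

  ≈P⇒SamePerm : ∀ {g h} → SL g → g ≈P h → SamePerm g h
  ≈P⇒SamePerm {g} {h} detg g≈h x detx = zero , ≈P-trans (·-congˡ-≈P (adj (g · x)) (·-congʳ-≈P x (≈P-sym g≈h)))
    (inj₁ (adj-inverseˡ (SL-· detg detx)))

  adj-·≈I⇒≈P : ∀ {g h} → SL g → (adj g · h) ≈P I → g ≈P h
  adj-·≈I⇒≈P {g} {h} detg eq = ≈P-sym (subst₂ _≈P_ (·-adj-cancelˡ h detg) (·-identityʳ g) (·-congˡ-≈P g eq))

  conj≈I⇒≈I : ∀ {x u} → SL x → conj x u ≈P I → u ≈P I
  conj≈I⇒≈I {x} {u} detx eq =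
    subst₂ _≈P_ (conj-adj u detx) (conj-I (SL-adj detx)) (conj-cong-≈P (adj x) eq)

  agree⇒TraceUnit : ∀ {g h} → SL g → ¬ SamePerm g h → (∃ λ x → SL x × AgreeAt g h x) → TraceUnit (adj g · h)
  agree⇒TraceUnit {g} {h} detg ¬same (x , detx , k , eq) = [ trivial , nontrivial ]′ (t^k-trace k)
    where
    u≈t^k : conj x (adj g · h) ≈P power k
    u≈t^k = subst (_≈P power k) (relative-position g h x) eq
    trivial : power k ≡ I → TraceUnit (adj g · h)
    trivial t^k≡I = contradiction
      (≈P⇒SamePerm detg (adj-·≈I⇒≈P detg (conj≈I⇒≈I detx (subst (conj x (adj g · h) ≈P_) t^k≡I u≈t^k)))) ¬same
    nontrivial : TraceUnit (power k) → TraceUnit (adj g · h)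
    nontrivial = subst (λ z → z ≡ 1# ⊎ z ≡ - 1#) (tr-conj (adj g · h) detx) ∘ TraceUnit-≈P (≈P-sym u≈t^k)

  TraceUnit⇒agree : ∀ {g h} → SL g → SL h → TraceUnit (adj g · h) → ∃ λ x → SL x × AgreeAt g h x
  TraceUnit⇒agree {g} {h} detg deth tru =
    let x , detx , eq = TraceUnit-conjugate (SL-adj-· detg deth) SL-t tru TraceUnit-t
    -- The witness is the exponent 1: x conjugates g⁻¹h to ±t.
    in x , detx , suc zero , subst₂ _≈P_ (sym (relative-position g h x)) (sym (·-identityʳ t)) eq

  -- If g and h acted alike, then u = g⁻¹h and all its conjugates would lie in the abelian group H,
  -- so u would commute with its conjugates by shears.
  TraceUnit⇒¬SamePerm : ∀ {g h} → SL g → SL h → TraceUnit (adj g · h) → ¬ SamePerm g h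
  TraceUnit⇒¬SamePerm {g} {h} detg deth tru same = not-scalar (adj g · h) (SL-adj-· detg deth) tru commute
    where
    u = adj g · h
    conj-InH : ∀ x → SL x → InH (conj x u)
    conj-InH x detx = subst InH (relative-position g h x) (same x detx)
    u-InH : InH u
    u-InH = subst InH (trans (relative-position g h I) (trans (cong (adj I ·_) (·-identityʳ u))
      (trans (cong (_· u) (trans (sym (·-identityʳ (adj I))) (adj-inverseˡ SL-I))) (·-identityˡ u)))) (same I SL-I)
    commute : ∀ k → u · conj (shear k) u ≡ conj (shear k) u · u
    commute k = InH-commute u-InH (conj-InH (shear k) (SL-shear k))
    not-scalar : ∀ u → SL u → TraceUnit u → ¬ (∀ k → u · conj (shear k) u ≡ conj (shear k) u · u)
    not-scalar (mat a b c d) detu tru commute =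
      TraceUnit⇒≉I tru′ (scalar⇒≈P-I detu′ a≡d)
      where
      c≡0 : c ≡ 0#
      c≡0 = proj₁ (shears-commute⇒scalar commute)
      a≡d : a ≡ d
      a≡d = proj₂ (shears-commute⇒scalar commute)
      detu′ : a * d + - (0# * 0#) ≡ 1#
      detu′ = trans (trans (cong (λ z → a * d + - z) (trans (zeroˡ 0#) (sym (zeroʳ b)))) (cong (λ z → a * d + - (b * z)) (sym c≡0))) detu
      -- Dropping b preserves the trace, and the resulting diagonal matrix is ±I, whose trace is not
      -- ±1.
      tru′ : TraceUnit (mat a 0# 0# d)
      tru′ = tru

  -- An element g that fixes xH is classified by the exponent k with (gx)⁻¹x = ±tᵏ, and this
  -- exponent determines g up to sign.
  stabiliser-bound : ∀ x L → SL x → All (λ g → SL g × Fixes x g) L → AllPairs (λ g h → ¬ SamePerm g h) L → length L ≤ 3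
  stabiliser-bound x L detx = classes-bound {R = SamePerm} (proj₁ ∘ proj₂) same
    where
    cancel : ∀ {g h} → SL g → SL h → (adj (g · x) · (I · x)) ≈P (adj (h · x) · (I · x)) → g ≈P h
    cancel {g} {h} detg deth eq = ≈P-sym (adj-·≈I⇒≈P deth (conj≈I⇒≈I detx
      (subst₂ _≈P_ (relative-position h g x) (adj-inverseˡ (SL-· deth detx)) (·-congˡ-≈P (adj (h · x)) gx≈hx))))
      where
      adj-gx≈adj-hx : adj (g · x) ≈P adj (h · x)
      adj-gx≈adj-hx = subst₂ _≈P_ (right-cancel g) (right-cancel h) (·-congʳ-≈P (adj x) eq)
        where
        right-cancel : ∀ g → (adj (g · x) · (I · x)) · adj x ≡ adj (g · x)
        right-cancel g = begin
          (adj (g · x) · (I · x)) · adj x ≡⟨ ·-assoc (adj (g · x)) _ (adj x) ⟩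
          adj (g · x) · ((I · x) · adj x) ≡⟨ cong (λ z → adj (g · x) · (z · adj x)) (·-identityˡ x) ⟩
          adj (g · x) · (x · adj x)       ≡⟨ cong (adj (g · x) ·_) (adj-inverseʳ detx) ⟩
          adj (g · x) · I                 ≡⟨ ·-identityʳ _ ⟩
          adj (g · x)                     ∎
      gx≈hx : (g · x) ≈P (h · x)
      gx≈hx = subst₂ _≈P_ (adj-involutive _) (adj-involutive _) (adj-cong-≈P adj-gx≈adj-hx)
    same : ∀ {g h} (pg : SL g × Fixes x g) (ph : SL h × Fixes x h) → proj₁ (proj₂ pg) ≡ proj₁ (proj₂ ph) → SamePerm g h
    same (detg , k , g-eq) (deth , .k , h-eq) refl = ≈P⇒SamePerm detg (cancel detg deth (≈P-trans g-eq (≈P-sym h-eq)))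

  SL-power : ∀ n → SL (t ^M n)
  SL-power zero    = SL-I
  SL-power (suc n) = SL-· SL-t (SL-power n)

  -- Fixing the base coset is expressed through g⁻¹. Listing the inverses of the powers makes the
  -- k-th position equal to `power k` itself.
  basePoint-stabiliser : List Mat
  basePoint-stabiliser = adj (power zero) ∷ adj (power (suc zero)) ∷ adj (power (suc (suc zero))) ∷ []

  I-position : ∀ g → adj (g · I) · (I · I) ≡ adj g
  I-position g = trans (cong₂ _·_ (cong adj (·-identityʳ g)) (·-identityʳ I)) (·-identityʳ (adj g))

  basePoint-enumerates : Enumerates (Fixes I) basePoint-stabiliser
  basePoint-enumerates = member zero ∷ member (suc zero) ∷ member (suc (suc zero)) ∷ []
    , (distinct zero (suc zero) (TraceUnit-I· (TraceUnit-power₁)) ∷ distinct zero (suc (suc zero)) (TraceUnit-I· TraceUnit-power₂) ∷ [])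
    ∷ (distinct (suc zero) (suc (suc zero)) power₁₂ ∷ []) ∷ [] ∷ []
    , complete
    where
    member : ∀ k → SL (adj (power k)) × Fixes I (adj (power k))
    member k = SL-adj (SL-power (toℕ k)) , k , inj₁ (trans (I-position (adj (power k))) (adj-involutive (power k)))
    distinct : ∀ i j → TraceUnit (power i · adj (power j)) → ¬ SamePerm (adj (power i)) (adj (power j))
    distinct i j tru = TraceUnit⇒¬SamePerm (SL-adj (SL-power (toℕ i))) (SL-adj (SL-power (toℕ j)))
      (subst (λ z → TraceUnit (z · adj (power j))) (sym (adj-involutive (power i))) tru)
    TraceUnit-I· : ∀ {x} → TraceUnit x → TraceUnit (I · adj x)
    TraceUnit-I· {x} tru = subst TraceUnit (sym (·-identityˡ (adj x))) (TraceUnit-adj x tru)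
    TraceUnit-power₁ : TraceUnit (power (suc zero))
    TraceUnit-power₁ = subst TraceUnit (sym (·-identityʳ t)) TraceUnit-t
    TraceUnit-power₂ : TraceUnit (power (suc (suc zero)))
    TraceUnit-power₂ = subst (λ z → TraceUnit (t · z)) (sym (·-identityʳ t)) TraceUnit-t·t
    power₁₂ : TraceUnit ((t · I) · adj (t · (t · I)))
    power₁₂ = subst TraceUnit (sym (begin
      (t · I) · adj (t · (t · I))       ≡⟨ cong (λ z → z · adj (t · z)) (·-identityʳ t) ⟩
      t · adj (t · t)                   ≡⟨ cong (t ·_) (adj-· t t) ⟩
      t · (adj t · adj t)               ≡⟨ ·-adj-cancelˡ (adj t) SL-t ⟩
      adj t                             ∎)) (TraceUnit-adj t TraceUnit-t)
    complete : ∀ g → SL g → Fixes I g → Any (SamePerm g) basePoint-stabiliser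
    complete g detg (k , eq) = located k (≈P⇒SamePerm detg (subst₂ _≈P_ (adj-involutive g) refl
        (adj-cong-≈P (subst (_≈P power k) (I-position g) eq))))
      where
      located : ∀ k → SamePerm g (adj (power k)) → Any (SamePerm g) basePoint-stabiliser
      located zero             = here
      located (suc zero)       = there ∘ here
      located (suc (suc zero)) = there ∘ there ∘ here

  -- The maximum is attained by a list subject to `stabiliser-bound`, and it is at least the length
  -- of the explicit stabiliser of the base coset.
  maxStab≡3 : ∀ {s} → MaxStab s → s ≡ 3
  maxStab≡3 ((x , detx , L , (fixes , distinct , _) , length≡s) , bound) = ℕ.≤-antisym
    (subst (_≤ 3) length≡s (stabiliser-bound x L detx fixes distinct))
    (bound I basePoint-stabiliser SL-I basePoint-enumerates)

-- Constructions of large intersecting sets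

AllPairs-map-All : ∀ {A : Set} {P : A → Set} {R S : A → A → Set} → (∀ {x y} → P x → P y → R x y → S x y) →
  ∀ {xs} → All P xs → AllPairs R xs → AllPairs S xs
AllPairs-map-All f []         []         = []
AllPairs-map-All f (px ∷ pxs) (rx ∷ rxs) = All.zipWith (λ (py , rxy) → f px py rxy) (pxs , rx) ∷ AllPairs-map-All f pxs rxs

module LowerBounds {q : ℕ} (K : FiniteField q)
  (3≢0 : FieldTheory.ι K (+ 3) ≢ FiniteField.0# K)
  (w : FiniteField.Carrier K) (w²≡w-1 : FieldTheory.SixthRoot K w)
  (t : PSL2.Mat K) (order3 : PSL2.Order3 K t) where
  open FiniteField K
  open FieldTheory K hiding (3≢0)
  open PSL2 K
  open Action t
  open Matrices K
  open Order3Elements K 3≢0 w w²≡w-1 t order3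
  open Permutations K 3≢0 w w²≡w-1 t order3

  TraceUnits⇒Intersecting : ∀ {L} → All SL L → AllPairs (λ g h → TraceUnit (adj g · h)) L → Intersecting L
  TraceUnits⇒Intersecting dets trs = dets , AllPairs-map-All TraceUnit⇒¬SamePerm dets trs , AllPairs-map-All TraceUnit⇒agree dets trs

  SL-D : SL D
  SL-D = combine₁ (- 1#) w²≡w-1 (solve 1 (λ w → w :* (con (+ 1) :- w) :- con (+ 0) :* con (+ 0) :=
    con (+ 1) :+ (:- con (+ 1)) :* (w :* w :- (w :- con (+ 1)))) refl w)

  TraceUnit-I· : ∀ x → tr x ≡ 1# → TraceUnit (adj I · x)
  TraceUnit-I· (mat a b c d) = inj₁ ∘ trans (solve 4 (λ a b c d →
    (con (+ 1) :* a :+ (:- con (+ 0)) :* c) :+ ((:- con (+ 0)) :* b :+ con (+ 1) :* d) := a :+ d) refl a b c d)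

  complementary-trace : ∀ a → a + (1# + - a) ≡ 1#
  complementary-trace = solve 1 (λ a → a :+ (con (+ 1) :- a) := con (+ 1)) refl

  -- X and Y have the diagonal of D⁻¹ and the isotropic vectors (1, 0) and (0, 1) off it. Hence B(D,
  -- ·) = w² + (1 - w)² = -1 for both, and B(X, Y) = 2w(1 - w) - 1 = 1.
  intersecting-4 : ∃ λ L → Intersecting L × length L ≡ 4
  intersecting-4 = (I ∷ D ∷ X ∷ Y ∷ []) , TraceUnits⇒Intersecting (SL-I ∷ SL-D ∷ SL-X ∷ SL-Y ∷ [])
    ((TraceUnit-I· D (complementary-trace w) ∷ TraceUnit-I· X (complementary-trace w̄) ∷ TraceUnit-I· Y (complementary-trace w̄) ∷ []) ∷
     (inj₂ DX ∷ inj₂ DY ∷ []) ∷ (inj₁ XY ∷ []) ∷ [] ∷ []) , refl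
    where
    X Y : Mat
    X = mat w̄ 1# 0# (1# + - w̄)
    Y = mat w̄ 0# 1# (1# + - w̄)
    SL-X : SL X
    SL-X = combine₁ (- 1#) w²≡w-1 (solve 1 (λ w → let w̄ = con (+ 1) :- w in
      w̄ :* (con (+ 1) :- w̄) :- con (+ 1) :* con (+ 0) :=
      con (+ 1) :+ (:- con (+ 1)) :* (w :* w :- (w :- con (+ 1)))) refl w)
    SL-Y : SL Y
    SL-Y = combine₁ (- 1#) w²≡w-1 (solve 1 (λ w → let w̄ = con (+ 1) :- w in
      w̄ :* (con (+ 1) :- w̄) :- con (+ 0) :* con (+ 1) :=
      con (+ 1) :+ (:- con (+ 1)) :* (w :* w :- (w :- con (+ 1)))) refl w)
    DX : tr (adj D · X) ≡ - 1#
    DX = combine₁ (ι (+ 2)) w²≡w-1 (solve 1 (λ w → let w̄ = con (+ 1) :- w in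
      (w̄ :* w̄ :+ (:- con (+ 0)) :* con (+ 0)) :+ ((:- con (+ 0)) :* con (+ 1) :+ w :* (con (+ 1) :- w̄)) :=
      (:- con (+ 1)) :+ con (+ 2) :* (w :* w :- (w :- con (+ 1)))) refl w)
    DY : tr (adj D · Y) ≡ - 1#
    DY = combine₁ (ι (+ 2)) w²≡w-1 (solve 1 (λ w → let w̄ = con (+ 1) :- w in
      (w̄ :* w̄ :+ (:- con (+ 0)) :* con (+ 1)) :+ ((:- con (+ 0)) :* con (+ 0) :+ w :* (con (+ 1) :- w̄)) :=
      (:- con (+ 1)) :+ con (+ 2) :* (w :* w :- (w :- con (+ 1)))) refl w)
    XY : tr (adj X · Y) ≡ 1#
    XY = combine₁ (- ι (+ 2)) w²≡w-1 (solve 1 (λ w → let w̄ = con (+ 1) :- w in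
      ((con (+ 1) :- w̄) :* w̄ :+ (:- con (+ 1)) :* con (+ 1)) :+ ((:- con (+ 0)) :* con (+ 0) :+ w̄ :* (con (+ 1) :- w̄)) :=
      con (+ 1) :+ (:- con (+ 2)) :* (w :* w :- (w :- con (+ 1)))) refl w)

  -- Six elements in characteristic 5

  module Characteristic5 (5≡0 : ι (+ 5) ≡ 0#) where

    -- The condition B(D, ·) = 1 forces 3a = w + 1, and 2 is the inverse of 3 modulo 5.
    α : Carrier
    α = ι (+ 2) * w + ι (+ 2)

    V : ℤ → ℤ → Mat
    V b c = mat α (ι b) (ι c) (1# + - α)

    ι-mod-5 : ∀ k r {n} → n ≡ r ℤ.+ + 5 ℤ.* k → ι n ≡ ι r
    ι-mod-5 k r refl = combine₁ (ι k) 5≡0 (trans (trans (ι-+ r (+ 5 ℤ.* k)) (cong (_+_ (ι r)) (ι-* (+ 5) k)))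
      (solve 2 (λ r k → r :+ con (+ 5) :* k := r :+ k :* (con (+ 5) :- con (+ 0))) refl (ι r) (ι k)))

    -- Here α(1 - α) = 2, so the determinant is 2 - bc. The quotient k turns the congruence modulo 5
    -- into an integer equation that `refl` can check.
    SL-V : ∀ b c k → + 2 ℤ.- b ℤ.* c ≡ + 1 ℤ.+ + 5 ℤ.* k → SL (V b c)
    SL-V b c k eq = trans
      (combine₂ (- (ι (+ 2) * w)) (- ι (+ 4)) 5≡0 w²≡w-1 (solve 3 (λ b c w → let α = con (+ 2) :* w :+ con (+ 2) in
        α :* (con (+ 1) :- α) :- b :* c := con (+ 2) :- b :* c :+ (:- (con (+ 2) :* w)) :* (con (+ 5) :- con (+ 0)) :+
          (:- con (+ 4)) :* (w :* w :- (w :- con (+ 1)))) refl (ι b) (ι c) w))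
      (trans (sym (trans (ι-+ (+ 2) (ℤ.- (b ℤ.* c))) (cong (_+_ (ι (+ 2))) (trans (ι-neg (b ℤ.* c)) (cong -_ (ι-* b c))))))
        (ι-mod-5 k (+ 1) eq))

    tr-V-V : ∀ b c b′ c′ k r → + 4 ℤ.- (b ℤ.* c′ ℤ.+ c ℤ.* b′) ≡ r ℤ.+ + 5 ℤ.* k → tr (adj (V b c) · V b′ c′) ≡ ι r
    tr-V-V b c b′ c′ k r eq = trans
      (combine₂ (- (ι (+ 4) * w)) (- ι (+ 8)) 5≡0 w²≡w-1 (solve 5 (λ b c b′ c′ w → let α = con (+ 2) :* w :+ con (+ 2) in
        ((con (+ 1) :- α) :* α :+ (:- b) :* c′) :+ ((:- c) :* b′ :+ α :* (con (+ 1) :- α)) :=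
        con (+ 4) :- (b :* c′ :+ c :* b′) :+ (:- (con (+ 4) :* w)) :* (con (+ 5) :- con (+ 0)) :+
          (:- con (+ 8)) :* (w :* w :- (w :- con (+ 1)))) refl (ι b) (ι c) (ι b′) (ι c′) w))
      (trans (sym (trans (ι-+ (+ 4) (ℤ.- h)) (cong (_+_ (ι (+ 4))) (trans (ι-neg h) (cong -_
        (trans (ι-+ (b ℤ.* c′) (c ℤ.* b′)) (cong₂ _+_ (ι-* b c′) (ι-* c b′))))))))
        (ι-mod-5 k r eq))
      where h = b ℤ.* c′ ℤ.+ c ℤ.* b′

    tr-D-V : ∀ b c → tr (adj D · V b c) ≡ 1#
    tr-D-V b c = combine₂ (1# + - w) (- ι (+ 4)) 5≡0 w²≡w-1 (solve 3 (λ b c w → let α = con (+ 2) :* w :+ con (+ 2) in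
      ((con (+ 1) :- w) :* α :+ (:- con (+ 0)) :* c) :+ ((:- con (+ 0)) :* b :+ w :* (con (+ 1) :- α)) :=
      con (+ 1) :+ (con (+ 1) :- w) :* (con (+ 5) :- con (+ 0)) :+ (:- con (+ 4)) :* (w :* w :- (w :- con (+ 1))))
      refl (ι b) (ι c) w)

    -- The vectors are the four points (b, b⁻¹) of the hyperbola bc = 1 over the prime field. For
    -- two of them with ratio r, B = 4 - (r + r⁻¹), which is 1 for r = -1 and -1 for r = ±2.
    intersecting-6 : ∃ λ L → Intersecting L × length L ≡ 6
    intersecting-6 = (I ∷ D ∷ V₁ ∷ V₂ ∷ V₃ ∷ V₄ ∷ []) , TraceUnits⇒Intersecting
      (SL-I ∷ SL-D ∷ SL-V (+ 1) (+ 1) (+ 0) refl ∷ SL-V -[1+ 0 ] -[1+ 0 ] (+ 0) refl ∷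
       SL-V (+ 2) (+ 3) -[1+ 0 ] refl ∷ SL-V -[1+ 1 ] -[1+ 2 ] -[1+ 0 ] refl ∷ [])
      ((TraceUnit-I· D (complementary-trace w) ∷ TraceUnit-I· V₁ α-trace ∷ TraceUnit-I· V₂ α-trace ∷
        TraceUnit-I· V₃ α-trace ∷ TraceUnit-I· V₄ α-trace ∷ []) ∷
       (inj₁ (tr-D-V (+ 1) (+ 1)) ∷ inj₁ (tr-D-V -[1+ 0 ] -[1+ 0 ]) ∷ inj₁ (tr-D-V (+ 2) (+ 3)) ∷ inj₁ (tr-D-V -[1+ 1 ] -[1+ 2 ]) ∷ []) ∷
       (inj₁ (tr-V-V (+ 1) (+ 1) -[1+ 0 ] -[1+ 0 ] (+ 1) (+ 1) refl) ∷
        inj₂ (tr-V-V (+ 1) (+ 1) (+ 2) (+ 3) (+ 0) -[1+ 0 ] refl) ∷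
        inj₂ (tr-V-V (+ 1) (+ 1) -[1+ 1 ] -[1+ 2 ] (+ 2) -[1+ 0 ] refl) ∷ []) ∷
       (inj₂ (tr-V-V -[1+ 0 ] -[1+ 0 ] (+ 2) (+ 3) (+ 2) -[1+ 0 ] refl) ∷
        inj₂ (tr-V-V -[1+ 0 ] -[1+ 0 ] -[1+ 1 ] -[1+ 2 ] (+ 0) -[1+ 0 ] refl) ∷ []) ∷
       (inj₁ (tr-V-V (+ 2) (+ 3) -[1+ 1 ] -[1+ 2 ] (+ 3) (+ 1) refl) ∷ []) ∷ [] ∷ []) , refl
      where
      V₁ V₂ V₃ V₄ : Mat
      V₁ = V (+ 1) (+ 1)
      V₂ = V -[1+ 0 ] -[1+ 0 ]
      V₃ = V (+ 2) (+ 3)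
      V₄ = V -[1+ 1 ] -[1+ 2 ]
      α-trace : α + (1# + - α) ≡ 1#
      α-trace = complementary-trace α

-- Upper bounds: from normalised matrices to integer data

AllPairs-reduce : ∀ {A B : Set} {P : A → Set} {R : A → A → Set} {S : B → B → Set} (f : ∀ {x} → P x → B) →
  (∀ {x y} (px : P x) (py : P y) → R x y → S (f px) (f py)) →
  ∀ {xs} (pxs : All P xs) → AllPairs R xs → AllPairs S (All.reduce f pxs)
AllPairs-reduce f g []         []         = []
AllPairs-reduce {P = P} {R} {S} f g (px ∷ pxs) (rx ∷ rxs) = head pxs rx ∷ AllPairs-reduce f g pxs rxs
  where
  head : ∀ {ys} (pys : All P ys) → All (R _) ys → All (S (f px)) (All.reduce f pys)
  head []         []         = []
  head (py ∷ pys) (rxy ∷ rs) = g px py rxy ∷ head pys rs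

length-reduce : ∀ {A B : Set} {P : A → Set} (f : ∀ {x} → P x → B) {xs} (pxs : All P xs) → length (All.reduce f pxs) ≡ length xs
length-reduce f []         = refl
length-reduce f (_ ∷ pxs) = cong suc (length-reduce f pxs)

module UpperBounds {q : ℕ} (K : FiniteField q)
  (3≢0 : FieldTheory.ι K (+ 3) ≢ FiniteField.0# K)
  (w : FiniteField.Carrier K) (w²≡w-1 : FieldTheory.SixthRoot K w)
  (t : PSL2.Mat K) (order3 : PSL2.Order3 K t) where
  open FiniteField K
  open FieldTheory K hiding (3≢0)
  open PSL2 K
  open Action t
  open Matrices K
  open Order3Elements K 3≢0 w w²≡w-1 t order3
  open Permutations K 3≢0 w w²≡w-1 t order3
  open ≡-Reasoning

  3-cancel : ∀ {x y} → ι (+ 3) * x ≡ ι (+ 3) * y → x ≡ y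
  3-cancel {x} {y} eq = x-y≡0⇒x≡y (*-nonzero-cancel 3≢0 (combine₁ 1# eq (solve 2 (λ x y →
    con (+ 3) :* (x :- y) := con (+ 0) :+ con (+ 1) :* (con (+ 3) :* x :- con (+ 3) :* y)) refl x y)))

  Normal : Mat → Set
  Normal v = SL v × tr v ≡ 1# × TraceUnit (adj D · v)

  -- The value of 3a forced by the type of a normal matrix with upper left entry a.
  corner : Bool → Carrier
  corner true  = w + 1#
  corner false = ι (+ 3) + - (ι (+ 3) * w)

  record OffDiagonal : Set where
    constructor offDiagonal
    field
      type     : Bool
      a b c    : Carrier
      3a≡corner : ι (+ 3) * a ≡ corner type
      3bc≡norm  : ι (+ 3) * (b * c) ≡ ι (norm type)
  open OffDiagonal

  -- The sign is kept as a witness because the finite check is indexed by the types and these signs.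
  Paired : OffDiagonal → OffDiagonal → Set
  Paired u v = ∃ λ s → ι (+ 3) * (b u * c v + c u * b v) ≡ ι (pairing (type u) (type v) s)

  cornerₚ : ∀ {n} → Bool → Polynomial n → Polynomial n
  cornerₚ true  w = w :+ con (+ 1)
  cornerₚ false w = con (+ 3) :- con (+ 3) :* w

  -- Trace and determinant 1 give bc = a(1 - a) - 1. Multiplied by 9 this becomes α(3 - α) - 9 with
  -- α = 3a, so no division by 3 is needed until the final cancellation.
  3bc-from-corner : ∀ τ {a b c d} → a + d ≡ 1# → a * d + - (b * c) ≡ 1# → ι (+ 3) * a ≡ corner τ →
    ι (+ 3) * (b * c) ≡ ι (norm τ)
  3bc-from-corner τ {a} {b} {c} {d} tr≡1 det≡1 3a≡ = 3-cancel (trans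
    (combine₃ (ι (+ 9) * a) (- ι (+ 9)) (ι (+ 3) + - (ι (+ 3) * a) + - corner τ) tr≡1 det≡1 3a≡ (solve 5 (λ a b c d α →
      con (+ 3) :* (con (+ 3) :* (b :* c)) := α :* (con (+ 3) :- α) :- con (+ 9) :+
        con (+ 9) :* a :* (a :+ d :- con (+ 1)) :+ (:- con (+ 9)) :* (a :* d :- b :* c :- con (+ 1)) :+
        (con (+ 3) :- con (+ 3) :* a :- α) :* (con (+ 3) :* a :- α)) refl a b c d (corner τ)))
    (value τ))
    where
    value : ∀ τ → corner τ * (ι (+ 3) + - corner τ) + - ι (+ 9) ≡ ι (+ 3) * ι (norm τ)
    value true  = combine₁ (- 1#) w²≡w-1 (solve 1 (λ w → let α = cornerₚ true w in
      α :* (con (+ 3) :- α) :- con (+ 9) := con (+ 3) :* con -[1+ 1 ] :+ (:- con (+ 1)) :* (w :* w :- (w :- con (+ 1)))) refl w)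
    value false = combine₁ (- ι (+ 9)) w²≡w-1 (solve 1 (λ w → let α = cornerₚ false w in
      α :* (con (+ 3) :- α) :- con (+ 9) := con (+ 3) :* con (+ 0) :+ (:- con (+ 9)) :* (w :* w :- (w :- con (+ 1)))) refl w)

  typeOf : ∀ v → TraceUnit v → Bool
  typeOf _ (inj₁ _) = true
  typeOf _ (inj₂ _) = false

  trace≡sign : ∀ v (tru : TraceUnit v) → tr v ≡ ι (sign (typeOf v tru))
  trace≡sign v (inj₁ eq) = eq
  trace≡sign v (inj₂ eq) = eq

  Normal⇒OffDiagonal : ∀ v → Normal v → OffDiagonal
  Normal⇒OffDiagonal (mat a b c d) (det≡1 , tr≡1 , trD) =
    offDiagonal (τ trD) a b c (3a≡ trD) (3bc-from-corner (τ trD) tr≡1 det≡1 (3a≡ trD))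
    where
    τ : TraceUnit (adj D · mat a b c d) → Bool
    τ = typeOf (adj D · mat a b c d)
    -- With d = 1 - a, the condition (1 - w)a + wd = ±1 has θ = 1 - 2w as the coefficient of a.
    -- Multiplying by θ produces θ² = -3.
    3a≡ : (trD : TraceUnit (adj D · mat a b c d)) → ι (+ 3) * a ≡ corner (τ trD)
    3a≡ (inj₁ eq) = combine₃ (- (1# + - (ι (+ 2) * w))) ((1# + - (ι (+ 2) * w)) * w) (ι (+ 4) * a + - ι (+ 2)) eq tr≡1 w²≡w-1
      (solve 5 (λ a b c d w → let θ = con (+ 1) :- con (+ 2) :* w in
        con (+ 3) :* a := cornerₚ true w :+
        (:- θ) :* (((con (+ 1) :- w) :* a :+ (:- con (+ 0)) :* c) :+ ((:- con (+ 0)) :* b :+ w :* d) :- con (+ 1)) :+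
        θ :* w :* (a :+ d :- con (+ 1)) :+ (con (+ 4) :* a :- con (+ 2)) :* (w :* w :- (w :- con (+ 1)))) refl a b c d w)
    3a≡ (inj₂ eq) = combine₃ (- (1# + - (ι (+ 2) * w))) ((1# + - (ι (+ 2) * w)) * w) (ι (+ 4) * a + - ι (+ 2)) eq tr≡1 w²≡w-1
      (solve 5 (λ a b c d w → let θ = con (+ 1) :- con (+ 2) :* w in
        con (+ 3) :* a := cornerₚ false w :+
        (:- θ) :* (((con (+ 1) :- w) :* a :+ (:- con (+ 0)) :* c) :+ ((:- con (+ 0)) :* b :+ w :* d) :- (:- con (+ 1))) :+
        θ :* w :* (a :+ d :- con (+ 1)) :+ (con (+ 4) :* a :- con (+ 2)) :* (w :* w :- (w :- con (+ 1)))) refl a b c d w)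

  -- Nine times bc′ + cb′ = a + a′ - 2aa′ - B, with 3a and 3a′ replaced by the values that the types
  -- force.
  pairingValue : Bool → Bool → Bool → Carrier
  pairingValue τ τ′ s =
    ι (+ 3) * corner τ + ι (+ 3) * corner τ′ + - (ι (+ 2) * (corner τ * corner τ′)) + - (ι (+ 9) * ι (sign s))

  -- The integer k is the cofactor of w² - w + 1. It is -2 times the product of the coefficients of
  -- w in the two corners, which are 1 and -3; hence -2, 6 and -18.
  pairingₚ : Bool → Bool → Bool → ℤ → Polynomial 1 → Polynomial 1 × Polynomial 1
  pairingₚ τ τ′ s k w =
    con (+ 3) :* cornerₚ τ w :+ con (+ 3) :* cornerₚ τ′ w :- con (+ 2) :* (cornerₚ τ w :* cornerₚ τ′ w) :- con (+ 9) :* con (sign s)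
      := con (+ 3) :* con (pairing τ τ′ s) :+ con k :* (w :* w :- (w :- con (+ 1)))

  pairing-value : ∀ τ τ′ s → pairingValue τ τ′ s ≡ ι (+ 3) * ι (pairing τ τ′ s)
  pairing-value true true true = combine₁ (ι -[1+ 1 ]) w²≡w-1 (solve 1 (pairingₚ true true true -[1+ 1 ]) refl w)
  pairing-value true true false = combine₁ (ι -[1+ 1 ]) w²≡w-1 (solve 1 (pairingₚ true true false -[1+ 1 ]) refl w)
  pairing-value true false true = combine₁ (ι (+ 6)) w²≡w-1 (solve 1 (pairingₚ true false true (+ 6)) refl w)
  pairing-value true false false = combine₁ (ι (+ 6)) w²≡w-1 (solve 1 (pairingₚ true false false (+ 6)) refl w)
  pairing-value false true true = combine₁ (ι (+ 6)) w²≡w-1 (solve 1 (pairingₚ false true true (+ 6)) refl w)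
  pairing-value false true false = combine₁ (ι (+ 6)) w²≡w-1 (solve 1 (pairingₚ false true false (+ 6)) refl w)
  pairing-value false false true = combine₁ (ι -[1+ 17 ]) w²≡w-1 (solve 1 (pairingₚ false false true -[1+ 17 ]) refl w)
  pairing-value false false false = combine₁ (ι -[1+ 17 ]) w²≡w-1 (solve 1 (pairingₚ false false false -[1+ 17 ]) refl w)

  Normal⇒Paired : ∀ u v (nu : Normal u) (nv : Normal v) → TraceUnit (adj u · v) →
    Paired (Normal⇒OffDiagonal u nu) (Normal⇒OffDiagonal v nv)
  Normal⇒Paired (mat a b c d) (mat a′ b′ c′ d′) nu@(_ , tr≡1 , _) nv@(_ , tr′≡1 , _) tru =
    s , 3-cancel (trans nine-h (pairing-value τ τ′ s))
    where
    s = typeOf (adj (mat a b c d) · mat a′ b′ c′ d′) tru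
    τ = type (Normal⇒OffDiagonal (mat a b c d) nu)
    τ′ = type (Normal⇒OffDiagonal (mat a′ b′ c′ d′) nv)
    h : b * c′ + c * b′ ≡ a + a′ + - (ι (+ 2) * (a * a′)) + - ι (sign s)
    h = combine₃ (- 1#) a′ a (trace≡sign (adj (mat a b c d) · mat a′ b′ c′ d′) tru) tr≡1 tr′≡1 (solve 9 (λ a b c d a′ b′ c′ d′ σ →
      b :* c′ :+ c :* b′ := a :+ a′ :- con (+ 2) :* (a :* a′) :- σ :+
        (:- con (+ 1)) :* ((d :* a′ :+ (:- b) :* c′) :+ ((:- c) :* b′ :+ a :* d′) :- σ) :+
        a′ :* (a :+ d :- con (+ 1)) :+ a :* (a′ :+ d′ :- con (+ 1))) refl a b c d a′ b′ c′ d′ (ι (sign s)))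
    nine-h : ι (+ 3) * (ι (+ 3) * (b * c′ + c * b′)) ≡ pairingValue τ τ′ s
    nine-h = combine₃ (ι (+ 9)) (ι (+ 3) + - (ι (+ 2) * (ι (+ 3) * a′))) (ι (+ 3) + - (ι (+ 2) * corner τ))
      h (3a≡corner (Normal⇒OffDiagonal (mat a b c d) nu)) (3a≡corner (Normal⇒OffDiagonal (mat a′ b′ c′ d′) nv)) (solve 6 (λ h a a′ α α′ σ →
      con (+ 3) :* (con (+ 3) :* h) := con (+ 3) :* α :+ con (+ 3) :* α′ :- con (+ 2) :* (α :* α′) :- con (+ 9) :* σ :+
        con (+ 9) :* (h :- (a :+ a′ :- con (+ 2) :* (a :* a′) :- σ)) :+
        (con (+ 3) :- con (+ 2) :* (con (+ 3) :* a′)) :* (con (+ 3) :* a :- α) :+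
        (con (+ 3) :- con (+ 2) :* α) :* (con (+ 3) :* a′ :- α′))
      refl (b * c′ + c * b′) a a′ (corner τ) (corner τ′) (ι (sign s)))

  -- Vanishing Gram determinants and the number of remaining elements

  ι-*₃ : ∀ x y z → ι (x ℤ.* y ℤ.* z) ≡ ι x * ι y * ι z
  ι-*₃ x y z = trans (ι-* (x ℤ.* y) z) (cong (_* ι z) (ι-* x y))

  ι-halfGram : ∀ x₁ x₂ x₃ h₁₂ h₁₃ h₂₃ → ι (halfGram x₁ x₂ x₃ h₁₂ h₁₃ h₂₃) ≡
    ι (+ 4) * (ι x₁ * ι x₂ * ι x₃) + ι h₁₂ * ι h₁₃ * ι h₂₃ +
      - (ι x₁ * ι h₂₃ * ι h₂₃ + ι x₂ * ι h₁₃ * ι h₁₃ + ι x₃ * ι h₁₂ * ι h₁₂)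
  ι-halfGram x₁ x₂ x₃ h₁₂ h₁₃ h₂₃ = begin
    ι (cubes ℤ.- squares)                ≡⟨ ι-+ cubes (ℤ.- squares) ⟩
    ι cubes + ι (ℤ.- squares)            ≡⟨ cong₂ _+_ ι-cubes (trans (ι-neg squares) (cong -_ ι-squares)) ⟩
    _                                    ∎
    where
    cubes squares squares′ : ℤ
    cubes = + 4 ℤ.* (x₁ ℤ.* x₂ ℤ.* x₃) ℤ.+ h₁₂ ℤ.* h₁₃ ℤ.* h₂₃
    squares′ = x₁ ℤ.* h₂₃ ℤ.* h₂₃ ℤ.+ x₂ ℤ.* h₁₃ ℤ.* h₁₃
    squares = squares′ ℤ.+ x₃ ℤ.* h₁₂ ℤ.* h₁₂
    ι-cubes : ι cubes ≡ ι (+ 4) * (ι x₁ * ι x₂ * ι x₃) + ι h₁₂ * ι h₁₃ * ι h₂₃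
    ι-cubes = trans (ι-+ (+ 4 ℤ.* (x₁ ℤ.* x₂ ℤ.* x₃)) (h₁₂ ℤ.* h₁₃ ℤ.* h₂₃)) (cong₂ _+_
      (trans (ι-* (+ 4) (x₁ ℤ.* x₂ ℤ.* x₃)) (cong (ι (+ 4) *_) (ι-*₃ x₁ x₂ x₃))) (ι-*₃ h₁₂ h₁₃ h₂₃))
    ι-squares : ι squares ≡ ι x₁ * ι h₂₃ * ι h₂₃ + ι x₂ * ι h₁₃ * ι h₁₃ + ι x₃ * ι h₁₂ * ι h₁₂
    ι-squares = trans (ι-+ squares′ (x₃ ℤ.* h₁₂ ℤ.* h₁₂)) (cong₂ _+_
      (trans (ι-+ (x₁ ℤ.* h₂₃ ℤ.* h₂₃) (x₂ ℤ.* h₁₃ ℤ.* h₁₃)) (cong₂ _+_ (ι-*₃ x₁ h₂₃ h₂₃) (ι-*₃ x₂ h₁₃ h₁₃)))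
      (ι-*₃ x₃ h₁₂ h₁₂))

  -- Half the Gram determinant of three vectors of the hyperbolic plane vanishes; unlike the determinant
  -- itself, this also carries information in characteristic 2.
  halfGram-vanishes : ∀ b₁ c₁ b₂ c₂ b₃ c₃ {x₁ x₂ x₃ h₁₂ h₁₃ h₂₃} →
    ι (+ 3) * (b₁ * c₁) ≡ x₁ → ι (+ 3) * (b₂ * c₂) ≡ x₂ → ι (+ 3) * (b₃ * c₃) ≡ x₃ →
    ι (+ 3) * (b₁ * c₂ + c₁ * b₂) ≡ h₁₂ → ι (+ 3) * (b₁ * c₃ + c₁ * b₃) ≡ h₁₃ → ι (+ 3) * (b₂ * c₃ + c₂ * b₃) ≡ h₂₃ →
    ι (+ 4) * (x₁ * x₂ * x₃) + h₁₂ * h₁₃ * h₂₃ + - (x₁ * h₂₃ * h₂₃ + x₂ * h₁₃ * h₁₃ + x₃ * h₁₂ * h₁₂) ≡ 0#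
  halfGram-vanishes b₁ c₁ b₂ c₂ b₃ c₃ refl refl refl refl refl refl = solve 6 (λ b₁ c₁ b₂ c₂ b₃ c₃ →
    let x₁ = con (+ 3) :* (b₁ :* c₁)
        x₂ = con (+ 3) :* (b₂ :* c₂)
        x₃ = con (+ 3) :* (b₃ :* c₃)
        h₁₂ = con (+ 3) :* (b₁ :* c₂ :+ c₁ :* b₂)
        h₁₃ = con (+ 3) :* (b₁ :* c₃ :+ c₁ :* b₃)
        h₂₃ = con (+ 3) :* (b₂ :* c₃ :+ c₂ :* b₃)
    in con (+ 4) :* (x₁ :* x₂ :* x₃) :+ h₁₂ :* h₁₃ :* h₂₃ :-
      (x₁ :* h₂₃ :* h₂₃ :+ x₂ :* h₁₃ :* h₁₃ :+ x₃ :* h₁₂ :* h₁₂) := con (+ 0)) refl b₁ c₁ b₂ c₂ b₃ c₃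

  tripleGram-vanishes : ∀ u v z (p : Paired u v) (q : Paired u z) (r : Paired v z) →
    ι (tripleGram (type u) (type v) (type z) (proj₁ p) (proj₁ q) (proj₁ r)) ≡ 0#
  tripleGram-vanishes u v z (s , p) (s′ , q) (s″ , r) = trans
    (ι-halfGram (norm (type u)) (norm (type v)) (norm (type z)) (pairing (type u) (type v) s) (pairing (type u) (type z) s′) (pairing (type v) (type z) s″))
    (halfGram-vanishes (b u) (c u) (b v) (c v) (b z) (c z) (3bc≡norm u) (3bc≡norm v) (3bc≡norm z) p q r)

  ∣-ι : ∀ {m n} → m ℤ.∣ n → ι m ≡ 0# → ι n ≡ 0#
  ∣-ι {m} (divides k refl) m≡0 = trans (ι-* k m) (trans (cong (ι k *_) m≡0) (zeroʳ (ι k)))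

  729≢0 : ι (+ 729) ≢ 0#
  729≢0 = 3^≢0 6
    where
    3^≢0 : ∀ n → ι (+ (3 ^ n)) ≢ 0#
    3^≢0 n = 3≢0 ∘ prime-power≡0 3 n

  -- The half determinant of a triple vanishes in K and divides 3645 = 5 · 729, but neither factor
  -- is zero in K.
  off-diagonal≤2 : ι (+ 5) ≢ 0# → ∀ L → AllPairs Paired L → length L ≤ 2
  off-diagonal≤2 5≢0 []          _ = z≤n
  off-diagonal≤2 5≢0 (_ ∷ [])     _ = s≤s z≤n
  off-diagonal≤2 5≢0 (_ ∷ _ ∷ []) _ = s≤s (s≤s z≤n)
  off-diagonal≤2 5≢0 (u ∷ v ∷ z ∷ _) ((p ∷ q ∷ _) ∷ (r ∷ _) ∷ _) = contradiction
    (∣-ι (proj₁ (tripleGram-divides (type u) (type v) (type z) (proj₁ p) (proj₁ q) (proj₁ r))) (tripleGram-vanishes u v z p q r))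
    (*-nonzero 5≢0 729≢0 ∘ trans (sym (ι-* (+ 5) (+ 729))))

  -- If 5 did not divide the half determinant, then this integer would divide 3⁶, and its vanishing
  -- in K would make a power of 3 vanish.
  triple-compatible : ∀ u v z (p : Paired u v) (q : Paired u z) (r : Paired v z) →
    Compatible (type u) (type v) (type z) (proj₁ p) (proj₁ q) (proj₁ r)
  triple-compatible u v z p q r = decidable-stable (compatible? (type u) (type v) (type z) (proj₁ p) (proj₁ q) (proj₁ r)) λ incompatible →
    729≢0 (∣-ι (proj₂ (tripleGram-divides (type u) (type v) (type z) (proj₁ p) (proj₁ q) (proj₁ r)) incompatible) (tripleGram-vanishes u v z p q r))

  off-diagonal≤4 : ∀ L → AllPairs Paired L → length L ≤ 4
  off-diagonal≤4 []                  _ = z≤n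
  off-diagonal≤4 (_ ∷ [])             _ = s≤s z≤n
  off-diagonal≤4 (_ ∷ _ ∷ [])         _ = s≤s (s≤s z≤n)
  off-diagonal≤4 (_ ∷ _ ∷ _ ∷ [])     _ = s≤s (s≤s (s≤s z≤n))
  off-diagonal≤4 (_ ∷ _ ∷ _ ∷ _ ∷ []) _ = s≤s (s≤s (s≤s (s≤s z≤n)))
  off-diagonal≤4 (u ∷ v ∷ x ∷ y ∷ z ∷ _)
    ((uv ∷ ux ∷ uy ∷ uz ∷ _) ∷ (vx ∷ vy ∷ vz ∷ _) ∷ (xy ∷ xz ∷ _) ∷ (yz ∷ _) ∷ _) = contradiction
    (triple-compatible x y z xy xz yz)
    (no-compatible-quintuple (type u) (type v) (type x) (proj₁ uv) (proj₁ ux) (proj₁ vx)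
      (triple-compatible u v x uv ux vx)
      (type y) (proj₁ uy) (proj₁ vy) (proj₁ xy)
      (triple-compatible u v y uv uy vy) (triple-compatible u x y ux uy xy) (triple-compatible v x y vx vy xy)
      (type z) (proj₁ uz) (proj₁ vz) (proj₁ xz) (proj₁ yz)
      (triple-compatible u v z uv uz vz) (triple-compatible u x z ux uz xz) (triple-compatible v x z vx vz xz)
      (triple-compatible u y z uy uz yz) (triple-compatible v y z vy vz yz))

  -- Moving an intersecting set to contain I and D

  adj-·-translate : ∀ {z} x y → SL z → adj (z · x) · (z · y) ≡ adj x · y
  adj-·-translate {z} x y detz = begin
    adj (z · x) · (z · y)       ≡⟨ cong (_· (z · y)) (adj-· z x) ⟩
    (adj x · adj z) · (z · y)   ≡⟨ ·-assoc (adj x) (adj z) _ ⟩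
    adj x · (adj z · (z · y))   ≡⟨ cong (adj x ·_) (adj-·-cancelˡ y detz) ⟩
    adj x · y                   ∎

  adj-conj : ∀ {P} x y → SL P → adj (conj P x) · conj P y ≡ conj P (adj x · y)
  adj-conj {P} x y detP = trans (adj-·-translate (x · P) (y · P) (SL-adj detP)) (relative-position x y P)

  TraceUnit-conj : ∀ {P} u → SL P → TraceUnit u → TraceUnit (conj P u)
  TraceUnit-conj u detP = subst (λ z → z ≡ 1# ⊎ z ≡ - 1#) (sym (tr-conj u detP))

  ·-cong-≈P : ∀ {x x′ y y′} → x ≈P x′ → y ≈P y′ → (x · y) ≈P (x′ · y′)
  ·-cong-≈P {x′ = x′} {y} x≈ y≈ = ≈P-trans (·-congʳ-≈P y x≈) (·-congˡ-≈P x′ y≈)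

  TraceUnit-adj-· : ∀ x x′ y y′ → x ≈P x′ → y ≈P y′ → TraceUnit (adj x · y) → TraceUnit (adj x′ · y′)
  TraceUnit-adj-· x x′ y y′ x≈ y≈ =
    TraceUnit-≈P {adj x · y} {adj x′ · y′} (·-cong-≈P {adj x} {adj x′} {y} {y′} (adj-cong-≈P {x} {x′} x≈) y≈)

  unit-trace-representative : ∀ u → SL u → TraceUnit u → ∃ λ v → SL v × tr v ≡ 1# × v ≈P u
  unit-trace-representative u detu (inj₁ eq) = u , detu , eq , inj₁ refl
  unit-trace-representative u detu (inj₂ eq) =
    negM u , SL-negM detu , trans (tr-negM u) (trans (cong -_ eq) (-‿involutive 1#)) , inj₂ refl

  -- The first element is moved to I and the second to D by translation, conjugation and sign changes.
  module Frame {g₁ g₂ P : Mat} (det₁ : SL g₁) (detP : SL P) (g₂≈D : conj P (adj g₁ · g₂) ≈P D) where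

    moved : Mat → Mat
    moved g = conj P (adj g₁ · g)

    -- Left translation does not change g⁻¹h, and conjugation by P preserves its trace.
    TraceUnit-moved : ∀ g h → TraceUnit (adj g · h) → TraceUnit (adj (moved g) · moved h)
    TraceUnit-moved g h tru = subst TraceUnit
      (sym (trans (adj-conj (adj g₁ · g) (adj g₁ · h) detP) (cong (conj P) (adj-·-translate g h (SL-adj det₁)))))
      (TraceUnit-conj (adj g · h) detP tru)

    Condition : Mat → Set
    Condition g = SL g × TraceUnit (adj g₁ · g) × TraceUnit (adj g₂ · g)

    -- Trace 1 fixes which of ± `moved g` is taken. The sign of B against D then becomes meaningful
    -- and serves as the type.
    record Representative (g : Mat) : Set where
      field
        rep     : Mat
        normal  : Normal rep
        rep≈    : rep ≈P moved g
    open Representative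

    represent : ∀ {g} → Condition g → Representative g
    represent {g} (detg , tr₁ , tr₂) =
      let v , detv , trv , v≈ = unit-trace-representative (moved g)
            (SL-conj {P} {adj g₁ · g} detP (SL-adj-· {g₁} {g} det₁ detg)) (TraceUnit-conj {P} (adj g₁ · g) detP tr₁)
      in record
        { rep    = v
        ; normal = detv , trv , TraceUnit-adj-· (moved g₂) D (moved g) v g₂≈D (≈P-sym {v} {moved g} v≈) (TraceUnit-moved g₂ g tr₂)
        ; rep≈   = v≈
        }

    offDiagonalOf : ∀ {g} → Representative g → OffDiagonal
    offDiagonalOf r = Normal⇒OffDiagonal (rep r) (normal r)

    representatives-paired : ∀ {g h} (r : Representative g) (r′ : Representative h) → TraceUnit (adj g · h) →
      Paired (offDiagonalOf r) (offDiagonalOf r′)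
    representatives-paired {g} {h} r r′ tru = Normal⇒Paired (rep r) (rep r′) (normal r) (normal r′)
      (TraceUnit-adj-· (moved g) (rep r) (moved h) (rep r′) (≈P-sym {rep r} {moved g} (rep≈ r)) (≈P-sym {rep r′} {moved h} (rep≈ r′)) (TraceUnit-moved g h tru))

    frame-bound : ∀ n → (∀ L → AllPairs Paired L → length L ≤ n) →
      ∀ L → All Condition L → AllPairs (λ g h → TraceUnit (adj g · h)) L → length L ≤ n
    frame-bound n bound L conditions traces = subst (_≤ n) (length-reduce offDiagonalOf representatives)
      (bound _ (AllPairs-reduce {S = Paired} offDiagonalOf representatives-paired representatives traces))
      where
      representatives : All Representative L
      representatives = All.map represent conditions

  -- The summand 2 counts the two elements that are moved to I and D; every other element
  -- contributes one off-diagonal vector.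
  intersecting-bound : ∀ n → (∀ L → AllPairs Paired L → length L ≤ n) → ∀ L → Intersecting L → length L ≤ 2 ℕ.+ n
  intersecting-bound n bound L (dets , distinct , agreeing) = from-traces dets
    (AllPairs-map-All (λ detg _ (¬same , agree) → agree⇒TraceUnit detg ¬same agree) dets (AllPairs.zip (distinct , agreeing)))
    where
    from-traces : ∀ {L} → All SL L → AllPairs (λ g h → TraceUnit (adj g · h)) L → length L ≤ 2 ℕ.+ n
    from-traces []       _ = z≤n
    from-traces (_ ∷ []) _ = s≤s z≤n
    from-traces {g₁ ∷ g₂ ∷ L} (det₁ ∷ det₂ ∷ dets) ((tr₁₂ ∷ trs₁) ∷ trs₂ ∷ traces) =
      let P , detP , eq = diagonalise (adj g₁ · g₂) (SL-adj-· {g₁} {g₂} det₁ det₂) tr₁₂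
      in s≤s (s≤s (Frame.frame-bound {g₁} {g₂} {P} det₁ detP eq n bound L (All.zip (dets , All.zip (trs₁ , trs₂))) traces))

-- The two values of the intersection density

theorem6p1 : (p e q : ℕ) → Prime p → 1 ≤ e → q ≡ p ^ e → q % 3 ≡ 1 →
    (K : FiniteField q) → (t : PSL2.Mat K) → PSL2.Order3 K t →
    (s : ℕ) → PSL2.Action.MaxStab K t s →
    (¬ (p ≡ 5) → PSL2.Action.Density K t s 4 3) ×
    (p ≡ 5 → PSL2.Action.Density K t s 2 1)
theorem6p1 p e q p-prime 1≤e q≡p^e q%3≡1 K t order3 s maxStab =
  (λ p≢5 → subst (λ s → Density s 4 3) (sym (maxStab≡3 maxStab)) (p≢5-case p≢5)) ,
  (λ p≡5 → subst (λ s → Density s 2 1) (sym (maxStab≡3 maxStab)) (p≡5-case p≡5))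
  where
  open FiniteField K using (Carrier; 0#)
  open FieldTheory K using (ι; q≡0; prime-power≡0; 5≢0; 3≢0; SixthRoot; sixth-root-of-unity)
  w : Carrier
  w = proj₁ (sixth-root-of-unity q%3≡1)
  w²≡w-1 : SixthRoot w
  w²≡w-1 = proj₂ (sixth-root-of-unity q%3≡1)
  open PSL2.Action K t using (Density)
  open Permutations K (3≢0 q%3≡1) w w²≡w-1 t order3
  open LowerBounds K (3≢0 q%3≡1) w w²≡w-1 t order3
  open UpperBounds K (3≢0 q%3≡1) w w²≡w-1 t order3

  p≡0 : ι (+ p) ≡ 0#
  p≡0 = prime-power≡0 p e (trans (cong (ι ∘ +_) (sym q≡p^e)) q≡0)

  -- Stabilisers have order 3, so density 4/3 amounts to a maximum of four elements, and density 2
  -- to a maximum of six.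
  p≢5-case : ¬ (p ≡ 5) → Density 3 4 3
  p≢5-case p≢5 =
    (let L , int , eq = intersecting-4 in L , int , cong (ℕ._* 3) eq) ,
    λ L int → ℕ.*-monoˡ-≤ 3 (intersecting-bound 2 (off-diagonal≤2 (5≢0 p-prime p≡0 p≢5)) L int)

  p≡5-case : p ≡ 5 → Density 3 2 1
  p≡5-case p≡5 =
    (let L , int , eq = Characteristic5.intersecting-6 5≡0 in L , int , cong (ℕ._* 1) eq) ,
    λ L int → ℕ.*-monoˡ-≤ 1 (intersecting-bound 4 off-diagonal≤4 L int)
    where
    5≡0 : ι (+ 5) ≡ 0#
    5≡0 = subst (λ n → ι (+ n) ≡ 0#) p≡5 p≡0
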